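{- Let $0<\lambda\le 1$ be a constant. Let $T_1,\dots,T_m$ be rooted node-labeled trees (the support vectors) and let $\alpha_1,\dots,\alpha_m$ be real weights. After a preprocessing step depending only on $T_1,\dots,T_m$ and $\alpha_1,\dots,\alpha_m$, the prediction value $$f(T)=\sum_{i=1}^{m}\alpha_i K(T_i,T)$$ for any rooted node-labeled tree $T$ given as a query can be computed in $O(|T|^2)$ time in the worst case, where the constant hidden in the $O$-notation does not depend on $m$ or on $T_1,\dots,T_m,\alpha_1,\dots,\alpha_m$.
   Context: Setting: all trees are rooted and their nodes carry labels from a totally ordered alphabet $\Sigma$; $|T|$ denotes the number of nodes of a tree $T$. Suffixes and prefixes: for a node $i$ of a tree $T$, the $i$-th suffix of $T$ is the string of node labels read along the path from node $i$ up to the root of $T$ (both endpoints included). A prefix of a string is a (nonempty) substring beginning with its first character. Subpath kernel: for trees $T',T''$, $$K(T',T'')=\sum_{s\in S}\lambda^{|s|}\,\mathrm{num}(T'_{s})\,\mathrm{num}(T''_{s}),$$ where $S$ is the set of all distinct strings that occur as a prefix of a suffix of $T'$ or of $T''$, $|s|$ is the length of $s$, and $\mathrm{num}(T'_s)$ is the number of nodes $i$ of $T'$ such that $s$ is a prefix of the $i$-th suffix of $T'$ (similarly for $T''$). Preprocessing and query: the preprocessing step builds a data structure from the support vectors and the weights (in the paper, an enhanced suffix array of the "master tree" obtained by concatenating all support vector trees); its cost is not counted in the prediction time. The prediction time is the time needed, given this stored data structure and a query tree $T$, to output $f(T)$. Computational model: unit-cost word RAM in which every label fits in one machine word, and arithmetic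 operations on the numbers involved in evaluating $f(T)$ (integers and real numbers) have unit cost. -}

module Defs where

open import Algebra.Bundles using (CommutativeRing; Semiring)
open import Data.Fin.Base as Fin using (Fin; toℕ)
import Data.Fin.Properties as Fin
import Data.Integer.Base as ℤ
open import Data.List.Base using
  (List; []; _∷_; _++_; map; foldr; length; concatMap; deduplicate; filter; module Inits)
open import Data.List.Properties using (≡-dec)
open import Data.List.Relation.Binary.Prefix.Heterogeneous.Properties using (prefix?)
open import Data.Maybe.Base using (Maybe; nothing; just)
open import Data.Nat.Base as ℕ using (ℕ; zero; suc)
open import Data.Nat.DivMod using (_mod_)
import Data.Nat.Properties as ℕ
open import Data.Product.Base using (Σ-syntax; ∃-syntax; _×_; _,_; proj₁; proj₂)
open import Data.Rational.Base as ℚ using (ℚ; 0ℚ; 1ℚ; ½; ∣_∣)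
import Data.Rational.Properties as ℚ
open import Data.Vec.Functional as Vector using (Vector)
open import Level using (0ℓ)
open import Relation.Binary.Core using (Rel)
open import Relation.Binary.Definitions using (DecidableEquality)
open import Relation.Binary.PropositionalEquality using
  (_≡_; refl; sym; trans; cong; cong₂; subst; module ≡-Reasoning)
open import Relation.Binary.Structures using (IsStrictTotalOrder)
open import Relation.Nullary using (¬_; yes; no)

------------------------------------------------------------------------
-- Real numbers: Cauchy sequences of rationals

Seq : Set
Seq = ℕ → ℚ

infix 4 _~_

-- The two indices are independent, so that x is Cauchy iff x ~ x; between
-- Cauchy sequences, ~ is the same as the difference tending to 0.
_~_ : Rel Seq 0ℓ
x ~ y = ∀ ε → 0ℚ ℚ.< ε →
        Σ[ N ∈ ℕ ] (∀ m n → N ℕ.≤ m → N ℕ.≤ n → ∣ x m ℚ.- y n ∣ ℚ.< ε)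

record ℝ : Set where
  constructor mkℝ
  field
    seq    : Seq
    cauchy : seq ~ seq

open ℝ public

infix 4 _≈_ _<_ _≤_

_≈_ : Rel ℝ 0ℓ
x ≈ y = seq x ~ seq y

_<_ : Rel ℝ 0ℓ
x < y = Σ[ ε ∈ ℚ ] 0ℚ ℚ.< ε ×
        Σ[ N ∈ ℕ ] (∀ n → N ℕ.≤ n → seq x n ℚ.+ ε ℚ.< seq y n)

_≤_ : Rel ℝ 0ℓ
x ≤ y = ¬ (y < x)

private

  half-pos : ∀ {ε} → 0ℚ ℚ.< ε → 0ℚ ℚ.< ½ ℚ.* ε
  half-pos {ε} 0<ε = subst (ℚ._< ½ ℚ.* ε) (ℚ.*-zeroʳ ½) (ℚ.*-monoʳ-<-pos ½ 0<ε)

  halves : ∀ ε → ½ ℚ.* ε ℚ.+ ½ ℚ.* ε ≡ ε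
  halves ε = trans (sym (ℚ.*-distribʳ-+ ε ½ ½)) (ℚ.*-identityˡ ε)

  module R = CommutativeRing ℚ.+-*-commutativeRing

  open import Algebra.Properties.Ring R.ring using (-‿involutive; -‿+-comm)
  open import Algebra.Properties.CommutativeSemigroup
    (CommutativeRing.+-commutativeSemigroup ℚ.+-*-commutativeRing) using (interchange)

  ∣p-q∣≡∣q-p∣ : ∀ p q → ∣ p ℚ.- q ∣ ≡ ∣ q ℚ.- p ∣
  ∣p-q∣≡∣q-p∣ p q = trans (sym (ℚ.∣-p∣≡∣p∣ (p ℚ.- q))) (cong ∣_∣ lemma)
    where
    lemma : ℚ.- (p ℚ.- q) ≡ q ℚ.- p
    lemma = trans (sym (-‿+-comm p (ℚ.- q)))
              (trans (cong (ℚ.- p ℚ.+_) (-‿involutive q)) (ℚ.+-comm (ℚ.- p) q))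

  split-mid : ∀ p q r → p ℚ.- r ≡ (p ℚ.- q) ℚ.+ (q ℚ.- r)
  split-mid p q r = sym (begin
    (p ℚ.- q) ℚ.+ (q ℚ.- r)       ≡⟨ ℚ.+-assoc p (ℚ.- q) (q ℚ.- r) ⟩
    p ℚ.+ (ℚ.- q ℚ.+ (q ℚ.- r))   ≡⟨ cong (p ℚ.+_) (sym (ℚ.+-assoc (ℚ.- q) q (ℚ.- r))) ⟩
    p ℚ.+ ((ℚ.- q ℚ.+ q) ℚ.- r)   ≡⟨ cong (λ z → p ℚ.+ (z ℚ.- r)) (ℚ.+-inverseˡ q) ⟩
    p ℚ.+ (0ℚ ℚ.- r)              ≡⟨ cong (p ℚ.+_) (ℚ.+-identityˡ (ℚ.- r)) ⟩
    p ℚ.- r                       ∎)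
    where open ≡-Reasoning

  split-+ : ∀ a b c d → (a ℚ.+ b) ℚ.- (c ℚ.+ d) ≡ (a ℚ.- c) ℚ.+ (b ℚ.- d)
  split-+ a b c d = trans (cong ((a ℚ.+ b) ℚ.+_) (sym (-‿+-comm c d)))
                      (interchange a b (ℚ.- c) (ℚ.- d))

  split-* : ∀ a b c d →
            (a ℚ.* b) ℚ.- (c ℚ.* d) ≡ a ℚ.* (b ℚ.- d) ℚ.+ (a ℚ.- c) ℚ.* d
  split-* a b c d = begin
    (a ℚ.* b) ℚ.- (c ℚ.* d)
      ≡⟨ split-mid (a ℚ.* b) (a ℚ.* d) (c ℚ.* d) ⟩
    (a ℚ.* b ℚ.- a ℚ.* d) ℚ.+ (a ℚ.* d ℚ.- c ℚ.* d)
      ≡⟨ cong₂ ℚ._+_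
           (trans (cong (a ℚ.* b ℚ.+_) (ℚ.neg-distribʳ-* a d)) (sym (ℚ.*-distribˡ-+ a b (ℚ.- d))))
           (trans (cong (a ℚ.* d ℚ.+_) (ℚ.neg-distribˡ-* c d)) (sym (ℚ.*-distribʳ-+ d a (ℚ.- c)))) ⟩
    a ℚ.* (b ℚ.- d) ℚ.+ (a ℚ.- c) ℚ.* d ∎
    where open ≡-Reasoning

  triangle : ∀ {ε} p q → ∣ p ∣ ℚ.< ½ ℚ.* ε → ∣ q ∣ ℚ.< ½ ℚ.* ε → ∣ p ℚ.+ q ∣ ℚ.< ε
  triangle {ε} p q p< q< = begin-strict
    ∣ p ℚ.+ q ∣            ≤⟨ ℚ.∣p+q∣≤∣p∣+∣q∣ p q ⟩
    ∣ p ∣ ℚ.+ ∣ q ∣        <⟨ ℚ.+-mono-< p< q< ⟩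
    ½ ℚ.* ε ℚ.+ ½ ℚ.* ε    ≡⟨ halves ε ⟩
    ε                      ∎
    where open ℚ.≤-Reasoning

  -- ∣ a ∣ < B  and  ∣ e ∣ < δ / B  give  ∣ a * e ∣ < δ.
  product-small : ∀ {B δ} (0<B : 0ℚ ℚ.< B) (0<δ : 0ℚ ℚ.< δ) →
                  Σ[ η ∈ ℚ ] 0ℚ ℚ.< η ×
                  (∀ a e → ∣ a ∣ ℚ.< B → ∣ e ∣ ℚ.< η → ∣ a ℚ.* e ∣ ℚ.< δ)
  product-small {B} {δ} 0<B 0<δ = η , 0<η , bound
    where
    instance
      B-pos : ℚ.Positive B
      B-pos = ℚ.positive 0<B
      B≢0 : ℚ.NonZero B
      B≢0 = ℚ.pos⇒nonZero B
      1/B-pos : ℚ.Positive (ℚ.1/ B)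
      1/B-pos = ℚ.1/pos⇒pos B
      B-nonNeg : ℚ.NonNegative B
      B-nonNeg = ℚ.pos⇒nonNeg B
    η : ℚ
    η = ℚ.1/ B ℚ.* δ
    0<η : 0ℚ ℚ.< η
    0<η = subst (ℚ._< η) (ℚ.*-zeroʳ (ℚ.1/ B)) (ℚ.*-monoʳ-<-pos (ℚ.1/ B) 0<δ)
    bound : ∀ a e → ∣ a ∣ ℚ.< B → ∣ e ∣ ℚ.< η → ∣ a ℚ.* e ∣ ℚ.< δ
    bound a e a<B e<η = begin-strict
      ∣ a ℚ.* e ∣             ≡⟨ ℚ.∣p*q∣≡∣p∣*∣q∣ a e ⟩
      ∣ a ∣ ℚ.* ∣ e ∣         ≤⟨ ℚ.*-monoʳ-≤-nonNeg ∣ e ∣ {{ℚ.∣-∣-nonNeg e}} (ℚ.<⇒≤ a<B) ⟩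
      B ℚ.* ∣ e ∣             <⟨ ℚ.*-monoʳ-<-pos B e<η ⟩
      B ℚ.* (ℚ.1/ B ℚ.* δ)    ≡⟨ sym (ℚ.*-assoc B (ℚ.1/ B) δ) ⟩
      (B ℚ.* ℚ.1/ B) ℚ.* δ    ≡⟨ cong (ℚ._* δ) (ℚ.*-inverseʳ B) ⟩
      1ℚ ℚ.* δ                ≡⟨ ℚ.*-identityˡ δ ⟩
      δ                       ∎
      where open ℚ.≤-Reasoning

  0<1 : 0ℚ ℚ.< 1ℚ
  0<1 = ℚ.positive⁻¹ 1ℚ

  eventually-bounded : ∀ {x} → x ~ x →
    Σ[ B ∈ ℚ ] 0ℚ ℚ.< B × Σ[ N ∈ ℕ ] (∀ n → N ℕ.≤ n → ∣ x n ∣ ℚ.< B)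
  eventually-bounded {x} cx = 1ℚ ℚ.+ ∣ x N ∣ , 0<B , N , bound
    where
    N : ℕ
    N = proj₁ (cx 1ℚ 0<1)
    0<B : 0ℚ ℚ.< 1ℚ ℚ.+ ∣ x N ∣
    0<B = ℚ.+-mono-<-≤ 0<1 (ℚ.0≤∣p∣ (x N))
    bound : ∀ n → N ℕ.≤ n → ∣ x n ∣ ℚ.< 1ℚ ℚ.+ ∣ x N ∣
    bound n N≤n = begin-strict
      ∣ x n ∣                       ≡⟨ cong ∣_∣ (sym (trans (cong (x n ℚ.- x N ℚ.+_) (sym (ℚ.+-identityʳ (x N))))
                                        (trans (sym (split-mid (x n) (x N) 0ℚ)) (ℚ.+-identityʳ (x n))))) ⟩
      ∣ (x n ℚ.- x N) ℚ.+ x N ∣     ≤⟨ ℚ.∣p+q∣≤∣p∣+∣q∣ (x n ℚ.- x N) (x N) ⟩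
      ∣ x n ℚ.- x N ∣ ℚ.+ ∣ x N ∣   <⟨ ℚ.+-monoˡ-< ∣ x N ∣ (proj₂ (cx 1ℚ 0<1) n N N≤n ℕ.≤-refl) ⟩
      1ℚ ℚ.+ ∣ x N ∣                ∎
      where open ℚ.≤-Reasoning

  ~-sym : ∀ {x y} → x ~ y → y ~ x
  ~-sym {x} {y} x~y ε 0<ε with N , close ← x~y ε 0<ε =
    N , λ m n N≤m N≤n → subst (ℚ._< ε) (∣p-q∣≡∣q-p∣ (x n) (y m)) (close n m N≤n N≤m)

  ~-trans : ∀ {x y z} → x ~ y → y ~ z → x ~ z
  ~-trans {x} {y} {z} x~y y~z ε 0<ε
    with N₁ , close₁ ← x~y (½ ℚ.* ε) (half-pos 0<ε)
    with N₂ , close₂ ← y~z (½ ℚ.* ε) (half-pos 0<ε)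
    = N₁ ℕ.⊔ N₂ , λ m n N≤m N≤n →
      subst (λ q → ∣ q ∣ ℚ.< ε) (sym (split-mid (x m) (y m) (z n)))
        (triangle (x m ℚ.- y m) (y m ℚ.- z n)
          (close₁ m m (ℕ.m⊔n≤o⇒m≤o N₁ N₂ N≤m) (ℕ.m⊔n≤o⇒m≤o N₁ N₂ N≤m))
          (close₂ m n (ℕ.m⊔n≤o⇒n≤o N₁ N₂ N≤m) (ℕ.m⊔n≤o⇒n≤o N₁ N₂ N≤n)))

  const-~ : ∀ q → (λ _ → q) ~ (λ _ → q)
  const-~ q ε 0<ε = 0 , λ _ _ _ _ →
    subst (λ p → ∣ p ∣ ℚ.< ε) (sym (ℚ.+-inverseʳ q)) 0<ε

  +-~ : ∀ {x x′ y y′} → x ~ x′ → y ~ y′ → (λ n → x n ℚ.+ y n) ~ (λ n → x′ n ℚ.+ y′ n)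
  +-~ {x} {x′} {y} {y′} x~ y~ ε 0<ε
    with N₁ , close₁ ← x~ (½ ℚ.* ε) (half-pos 0<ε)
    with N₂ , close₂ ← y~ (½ ℚ.* ε) (half-pos 0<ε)
    = N₁ ℕ.⊔ N₂ , λ m n N≤m N≤n →
      subst (λ q → ∣ q ∣ ℚ.< ε) (sym (split-+ (x m) (y m) (x′ n) (y′ n)))
        (triangle (x m ℚ.- x′ n) (y m ℚ.- y′ n)
          (close₁ m n (ℕ.m⊔n≤o⇒m≤o N₁ N₂ N≤m) (ℕ.m⊔n≤o⇒m≤o N₁ N₂ N≤n))
          (close₂ m n (ℕ.m⊔n≤o⇒n≤o N₁ N₂ N≤m) (ℕ.m⊔n≤o⇒n≤o N₁ N₂ N≤n)))

  neg-~ : ∀ {x y} → x ~ y → (λ n → ℚ.- x n) ~ (λ n → ℚ.- y n)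
  neg-~ {x} {y} x~y ε 0<ε with N , close ← x~y ε 0<ε =
    N , λ m n N≤m N≤n →
      subst (ℚ._< ε)
        (trans (sym (ℚ.∣-p∣≡∣p∣ (x m ℚ.- y n))) (cong ∣_∣ (sym (-‿+-comm (x m) (ℚ.- y n)))))
        (close m n N≤m N≤n)

  *-~ : ∀ {x x′ y y′} → x ~ x → y′ ~ y′ → x ~ x′ → y ~ y′ →
        (λ n → x n ℚ.* y n) ~ (λ n → x′ n ℚ.* y′ n)
  *-~ {x} {x′} {y} {y′} cx cy′ x~ y~ ε 0<ε
    with A , 0<A , N₁ , x-bound ← eventually-bounded {x} cx
    with B , 0<B , N₂ , y-bound ← eventually-bounded {y′} cy′
    with η , 0<η , small₁ ← product-small 0<A (half-pos 0<ε)
    with θ , 0<θ , small₂ ← product-small 0<B (half-pos 0<ε)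
    with N₃ , y-close ← y~ η 0<η
    with N₄ , x-close ← x~ θ 0<θ
    = (N₁ ℕ.⊔ N₂) ℕ.⊔ (N₃ ℕ.⊔ N₄) , λ m n N≤m N≤n →
      let l : ∀ {k} → (N₁ ℕ.⊔ N₂) ℕ.⊔ (N₃ ℕ.⊔ N₄) ℕ.≤ k → N₁ ℕ.⊔ N₂ ℕ.≤ k
          l = ℕ.m⊔n≤o⇒m≤o (N₁ ℕ.⊔ N₂) (N₃ ℕ.⊔ N₄)
          r : ∀ {k} → (N₁ ℕ.⊔ N₂) ℕ.⊔ (N₃ ℕ.⊔ N₄) ℕ.≤ k → N₃ ℕ.⊔ N₄ ℕ.≤ k
          r = ℕ.m⊔n≤o⇒n≤o (N₁ ℕ.⊔ N₂) (N₃ ℕ.⊔ N₄)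
      in
      subst (λ q → ∣ q ∣ ℚ.< ε) (sym (split-* (x m) (y m) (x′ n) (y′ n)))
        (triangle (x m ℚ.* (y m ℚ.- y′ n)) ((x m ℚ.- x′ n) ℚ.* y′ n)
          (small₁ (x m) (y m ℚ.- y′ n)
            (x-bound m (ℕ.m⊔n≤o⇒m≤o N₁ N₂ (l N≤m)))
            (y-close m n (ℕ.m⊔n≤o⇒m≤o N₃ N₄ (r N≤m)) (ℕ.m⊔n≤o⇒m≤o N₃ N₄ (r N≤n))))
          (subst (λ q → ∣ q ∣ ℚ.< ½ ℚ.* ε) (ℚ.*-comm (y′ n) (x m ℚ.- x′ n))
            (small₂ (y′ n) (x m ℚ.- x′ n)
              (y-bound n (ℕ.m⊔n≤o⇒n≤o N₁ N₂ (l N≤n)))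
              (x-close m n (ℕ.m⊔n≤o⇒n≤o N₃ N₄ (r N≤m)) (ℕ.m⊔n≤o⇒n≤o N₃ N₄ (r N≤n))))))

  pointwise : ∀ x y → (∀ n → seq x n ≡ seq y n) → x ≈ y
  pointwise x y eq ε 0<ε with N , close ← cauchy x ε 0<ε =
    N , λ m n N≤m N≤n →
      subst (λ q → ∣ seq x m ℚ.- q ∣ ℚ.< ε) (eq n) (close m n N≤m N≤n)

infixl 6 _+_
infixl 7 _*_
infix  8 -_

_+_ : ℝ → ℝ → ℝ
x + y = mkℝ (λ n → seq x n ℚ.+ seq y n)
            (+-~ {seq x} {seq x} {seq y} {seq y} (cauchy x) (cauchy y))

_*_ : ℝ → ℝ → ℝ
x * y = mkℝ (λ n → seq x n ℚ.* seq y n)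
            (*-~ {seq x} {seq x} {seq y} {seq y} (cauchy x) (cauchy y) (cauchy x) (cauchy y))

-_ : ℝ → ℝ
- x = mkℝ (λ n → ℚ.- seq x n) (neg-~ {seq x} {seq x} (cauchy x))

fromℚ : ℚ → ℝ
fromℚ q = mkℝ (λ _ → q) (const-~ q)

fromℕ : ℕ → ℝ
fromℕ n = fromℚ (ℤ.+ n ℚ./ 1)

0ℝ 1ℝ : ℝ
0ℝ = fromℚ 0ℚ
1ℝ = fromℚ 1ℚ

ℝ-commutativeRing : CommutativeRing 0ℓ 0ℓ
ℝ-commutativeRing = record
  { Carrier = ℝ
  ; _≈_ = _≈_
  ; _+_ = _+_
  ; _*_ = _*_
  ; -_ = -_
  ; 0# = 0ℝ
  ; 1# = 1ℝ
  ; isCommutativeRing = record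
    { isRing = record
      { +-isAbelianGroup = record
        { isGroup = record
          { isMonoid = record
            { isSemigroup = record
              { isMagma = record
                { isEquivalence = record
                  { refl  = λ {x} → cauchy x
                  ; sym   = λ {x} {y} → ~-sym {seq x} {seq y}
                  ; trans = λ {x} {y} {z} → ~-trans {seq x} {seq y} {seq z}
                  }
                ; ∙-cong = λ {x} {x′} {y} {y′} → +-~ {seq x} {seq x′} {seq y} {seq y′}
                }
              ; assoc = λ x y z → pointwise ((x + y) + z) (x + (y + z))
                          λ n → ℚ.+-assoc (seq x n) (seq y n) (seq z n)
              }
            ; identity = (λ x → pointwise (0ℝ + x) x λ n → ℚ.+-identityˡ (seq x n))
                       , (λ x → pointwise (x + 0ℝ) x λ n → ℚ.+-identityʳ (seq x n))
            }
          ; inverse = (λ x → pointwise (- x + x) 0ℝ λ n → ℚ.+-inverseˡ (seq x n))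
                    , (λ x → pointwise (x + - x) 0ℝ λ n → ℚ.+-inverseʳ (seq x n))
          ; ⁻¹-cong = λ {x} {y} → neg-~ {seq x} {seq y}
          }
        ; comm = λ x y → pointwise (x + y) (y + x) λ n → ℚ.+-comm (seq x n) (seq y n)
        }
      ; *-cong = λ {x} {x′} {y} {y′} →
          *-~ {seq x} {seq x′} {seq y} {seq y′} (cauchy x) (cauchy y′)
      ; *-assoc = λ x y z → pointwise ((x * y) * z) (x * (y * z))
                    λ n → ℚ.*-assoc (seq x n) (seq y n) (seq z n)
      ; *-identity = (λ x → pointwise (1ℝ * x) x λ n → ℚ.*-identityˡ (seq x n))
                   , (λ x → pointwise (x * 1ℝ) x λ n → ℚ.*-identityʳ (seq x n))
      ; distrib = (λ x y z → pointwise (x * (y + z)) (x * y + x * z)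
                     λ n → ℚ.*-distribˡ-+ (seq x n) (seq y n) (seq z n))
                , (λ x y z → pointwise ((y + z) * x) (y * x + z * x)
                     λ n → ℚ.*-distribʳ-+ (seq x n) (seq y n) (seq z n))
      }
    ; *-comm = λ x y → pointwise (x * y) (y * x) λ n → ℚ.*-comm (seq x n) (seq y n)
    }
  }

open import Algebra.Definitions.RawSemiring
  (Semiring.rawSemiring (CommutativeRing.semiring ℝ-commutativeRing)) public
  using (_^_) renaming (sum to ∑)

------------------------------------------------------------------------
-- Labelled trees and the subpath kernel

record Alphabet : Set₁ where
  field
    Label              : Set
    _≺_                : Rel Label 0ℓ
    isStrictTotalOrder : IsStrictTotalOrder _≡_ _≺_

  open IsStrictTotalOrder isStrictTotalOrder public using (_≟_)

data Tree (A : Set) : Set where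
  node : A → List (Tree A) → Tree A

module _ {A : Set} where

  mutual
    size : Tree A → ℕ
    size (node _ ts) = suc (sizes ts)

    sizes : List (Tree A) → ℕ
    sizes []       = 0
    sizes (t ∷ ts) = size t ℕ.+ sizes ts

  -- suffixesBelow u T lists, one entry per node of T, the labels from that
  -- node up to the root of T, followed by u.
  mutual
    suffixesBelow : List A → Tree A → List (List A)
    suffixesBelow u (node a ts) = (a ∷ u) ∷ suffixesBelow* (a ∷ u) ts

    suffixesBelow* : List A → List (Tree A) → List (List A)
    suffixesBelow* u []       = []
    suffixesBelow* u (t ∷ ts) = suffixesBelow u t ++ suffixesBelow* u ts

  suffixes : Tree A → List (List A)
  suffixes = suffixesBelow []

  -- Inits.tail enumerates the nonempty prefixes of a list.
  subpaths : Tree A → List (List A)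
  subpaths T = concatMap Inits.tail (suffixes T)

module Kernel {A : Set} (_≟_ : DecidableEquality A) where

  num : Tree A → List A → ℕ
  num T s = length (filter (prefix? _≟_ s) (suffixes T))

  distinctSubpaths : Tree A → Tree A → List (List A)
  distinctSubpaths T′ T″ = deduplicate (≡-dec _≟_) (subpaths T′ ++ subpaths T″)

  K : (decay : ℝ) → Tree A → Tree A → ℝ
  K decay T′ T″ =
    foldr _+_ 0ℝ (map (λ s → decay ^ length s * fromℕ (num T′ s) * fromℕ (num T″ s))
                      (distinctSubpaths T′ T″))

  f : (decay : ℝ) {m : ℕ} → Vector (Tree A) m → Vector ℝ m → Tree A → ℝ
  f decay Ts αs T = ∑ (λ i → αs i * K decay (Ts i) T)

totalSize : {A : Set} {m : ℕ} → Vector (Tree A) m → ℕ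
totalSize Ts = Vector.foldr ℕ._+_ 0 (λ i → size (Ts i))

------------------------------------------------------------------------
-- Word RAM with a second bank of registers and of memory for reals

Word : ℕ → Set
Word w = Fin (2 ℕ.^ w)

word : ∀ w → ℕ → Word w
word w n = _mod_ n (2 ℕ.^ w) {{ℕ.m^n≢0 2 w}}

Reg Loc : Set
Reg = ℕ
Loc = ℕ

data WordOp : Set where
  add sub mul quot rem : WordOp

data RealOp : Set where
  add sub mul : RealOp

-- The first register of an instruction is its target, except for the stores,
-- which write the second register at the address held by the first.  There is
-- neither comparison nor division of reals, and a program contains no real
-- constants: reals other than images of words come from the memory.
data Instr : Set where
  wconst        : Reg → ℕ → Instr
  wmove         : Reg → Reg → Instr
  wop           : WordOp → Reg → Reg → Reg → Instr
  wload wstore  : Reg → Reg → Instr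
  jump          : Loc → Instr
  jumpEq jumpLt : Reg → Reg → Loc → Instr
  fromWord      : Reg → Reg → Instr
  rmove         : Reg → Reg → Instr
  rop           : RealOp → Reg → Reg → Reg → Instr
  rload rstore  : Reg → Reg → Instr

Program : Set
Program = List Instr

nth : {A : Set} → List A → ℕ → Maybe A
nth []       _       = nothing
nth (x ∷ _)  zero    = just x
nth (_ ∷ xs) (suc i) = nth xs i

nthOr : {A : Set} → A → List A → ℕ → A
nthOr d xs i with nth xs i
... | just x  = x
... | nothing = d

-- Arithmetic modulo 2 ^ w; dividing by zero gives zero.
evalWord : ∀ w → WordOp → Word w → Word w → Word w
evalWord w add  a b = word w (toℕ a ℕ.+ toℕ b)
evalWord w sub  a b = word w ((2 ℕ.^ w ℕ.+ toℕ a) ℕ.∸ toℕ b)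
evalWord w mul  a b = word w (toℕ a ℕ.* toℕ b)
evalWord w quot a b with toℕ b
... | zero  = word w 0
... | suc d = word w (toℕ a ℕ./ suc d)
evalWord w rem  a b with toℕ b
... | zero  = word w 0
... | suc d = word w (toℕ a ℕ.% suc d)

evalReal : RealOp → ℝ → ℝ → ℝ
evalReal add x y = x + y
evalReal sub x y = x + - y
evalReal mul x y = x * y

record State (w : ℕ) : Set where
  constructor state
  field
    pc   : Loc
    wreg : Reg → Word w
    rreg : Reg → ℝ
    wmem : Word w → Word w
    rmem : Word w → ℝ

open State public

updateReg : {A : Set} → (Reg → A) → Reg → A → (Reg → A)
updateReg g r v r′ with r′ ℕ.≟ r
... | yes _ = v
... | no  _ = g r′

updateMem : {n : ℕ} {A : Set} → (Fin n → A) → Fin n → A → (Fin n → A)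
updateMem g a v a′ with a′ Fin.≟ a
... | yes _ = v
... | no  _ = g a′

exec : ∀ {w} → Instr → State w → State w
exec {w} (wconst r n)     (state l g x h y) = state (suc l) (updateReg g r (word w n)) x h y
exec     (wmove r a)      (state l g x h y) = state (suc l) (updateReg g r (g a)) x h y
exec {w} (wop o r a b)    (state l g x h y) = state (suc l) (updateReg g r (evalWord w o (g a) (g b))) x h y
exec     (wload r a)      (state l g x h y) = state (suc l) (updateReg g r (h (g a))) x h y
exec     (wstore a b)     (state l g x h y) = state (suc l) g x (updateMem h (g a) (g b)) y
exec     (jump l′)        (state l g x h y) = state l′ g x h y
exec     (jumpEq a b l′)  (state l g x h y) with toℕ (g a) ℕ.≟ toℕ (g b)
... | yes _ = state l′ g x h y
... | no  _ = state (suc l) g x h y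
exec     (jumpLt a b l′)  (state l g x h y) with toℕ (g a) ℕ.<? toℕ (g b)
... | yes _ = state l′ g x h y
... | no  _ = state (suc l) g x h y
exec     (fromWord r a)   (state l g x h y) = state (suc l) g (updateReg x r (fromℕ (toℕ (g a)))) h y
exec     (rmove r a)      (state l g x h y) = state (suc l) g (updateReg x r (x a)) h y
exec     (rop o r a b)    (state l g x h y) = state (suc l) g (updateReg x r (evalReal o (x a) (x b))) h y
exec     (rload r a)      (state l g x h y) = state (suc l) g (updateReg x r (y (g a))) h y
exec     (rstore a b)     (state l g x h y) = state (suc l) g x h (updateMem y (g a) (x b))

-- The machine halts when the program counter leaves the program.
Halted : ∀ {w} → Program → State w → Set
Halted P s = nth P (pc s) ≡ nothing

step : ∀ {w} → Program → State w → State w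
step P s with nth P (pc s)
... | just i  = exec i s
... | nothing = s

run : ∀ {w} → Program → ℕ → State w → State w
run P zero    s = s
run P (suc t) s = run P t (step P s)

------------------------------------------------------------------------
-- Queries

record DataStructure (w : ℕ) : Set where
  field
    words : List (Word w)
    reals : List ℝ

open DataStructure public

-- nodesFrom p i T lists the nodes of T, numbered from i on in preorder, each
-- with its label and the number of its parent; p stands for the parent of
-- the root.
mutual
  nodesFrom : {A : Set} → ℕ → ℕ → Tree A → List (A × ℕ)
  nodesFrom p i (node a ts) = (a , p) ∷ nodesFrom* i (suc i) ts

  nodesFrom* : {A : Set} → ℕ → ℕ → List (Tree A) → List (A × ℕ)
  nodesFrom* p i []       = []
  nodesFrom* p i (t ∷ ts) = nodesFrom p i t ++ nodesFrom* p (i ℕ.+ size t) ts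

-- The array of labels followed by the array of parents; nodes are numbered
-- from 0, and the root is its own parent.
encodeTree : {A : Set} (w : ℕ) → (A → Word w) → Tree A → List (Word w)
encodeTree w code T = map (λ v → code (proj₁ v)) vs ++ map (λ v → word w (proj₂ v)) vs
  where vs = nodesFrom 0 0 T

module _ {A : Set} {w : ℕ} (code : A → Word w) (D : DataStructure w) (T : Tree A) where

  wordImage : List (Word w)
  wordImage = words D ++ encodeTree w code T

  Fits : Set
  Fits = length wordImage ℕ.≤ 2 ℕ.^ w × length (reals D) ℕ.≤ 2 ℕ.^ w

  -- Register 0 holds the address of the query, register 1 its number of nodes.
  initialRegs : Reg → Word w
  initialRegs 0 = word w (length (words D))
  initialRegs 1 = word w (size T)
  initialRegs _ = word w 0

  initial : State w
  initial = record
    { pc   = 0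
    ; wreg = initialRegs
    ; rreg = λ _ → 0ℝ
    ; wmem = λ a → nthOr (word w 0) wordImage (toℕ a)
    ; rmem = λ a → nthOr 0ℝ (reals D) (toℕ a)
    }

  OutputsWithin : Program → ℕ → ℝ → Set
  OutputsWithin P bound y =
    ∃[ t ] t ℕ.≤ bound × Halted P (run P t initial) × rreg (run P t initial) 0 ≈ y

{-# OPTIONS --safe #-}

-- Expanding num(T_s) as a sum over the nodes of T gives
--   f(T) = Σ_j Σ_{s nonempty prefix of the j-th suffix of T} W(s),
--   W(s) = Σ_i α_i λ^|s| num((T_i)_s),
-- where W depends on the support vectors only.  The data structure is the trie of
-- the subpaths of the support vectors, with W(s) stored at the node of s, so that
-- walking from each node of T up to its root, in the tree and in the trie at the
-- same time, takes O(|T|²) steps.  For a step in the trie to take constant time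
-- over any alphabet, each label is split into two digits below B = 2^⌈w/2⌉ and the
-- trie is built over these digits: it then has only polynomially many nodes in
-- the total size, and a full table of B transitions at each of them still fits
-- into the memory.

module Submission where

open import Defs hiding (_+_; _*_; -_; _≈_)
open import Algebra.Bundles using (CommutativeRing)
open import Data.Fin.Base as Fin using (Fin; toℕ; zero; suc)
import Data.Fin.Properties as Fin
import Data.Integer.Base as ℤ
import Data.Integer.Properties as ℤ
open import Data.List.Base using
  (List; []; _∷_; _++_; _∷ʳ_; [_]; map; foldl; foldr; filter; length; concatMap; deduplicate;
   applyUpTo; module Inits)
open import Data.List.Membership.DecPropositional using () renaming (_∈?_ to member?)
open import Data.List.Membership.Propositional using (_∈_; _∉_)
open import Data.List.Membership.Propositional.Properties using
  (∈-map⁺; ∈-map⁻; ∈-++⁺ˡ; ∈-++⁺ʳ; ∈-++⁻; ∈-filter⁺; ∈-filter⁻; ∈-deduplicate⁺; ∈-deduplicate⁻)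
open import Data.List.Membership.Propositional.Properties.WithK using (unique∧set⇒bag)
open import Data.List.Properties using
  (≡-dec; ++-assoc; concatMap-++; filter-none; foldl-++; length-++; length-applyUpTo;
   length-map; map-cong; map-id; map-∘)
open import Data.List.Relation.Binary.BagAndSetEquality using (∼bag⇒↭)
open import Data.List.Relation.Binary.Permutation.Propositional as Perm using (_↭_)
open import Data.List.Relation.Binary.Prefix.Heterogeneous using (Prefix; []; _∷_)
open import Data.List.Relation.Binary.Prefix.Heterogeneous.Properties using (prefix?)
open import Data.List.Relation.Unary.All as All using (All; []; _∷_)
import Data.List.Relation.Unary.All.Properties as All
open import Data.List.Relation.Unary.AllPairs using ([]; _∷_)
open import Data.List.Relation.Unary.Any using (here; there)
open import Data.List.Relation.Unary.Unique.DecPropositional.Properties using (deduplicate-!)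
open import Data.List.Relation.Unary.Unique.Propositional using (Unique)
open import Data.List.Relation.Unary.Unique.Propositional.Properties using (map⁺; filter⁺)
open import Data.Maybe.Base using (nothing; just; maybe′)
open import Data.Nat.Base as ℕ using (ℕ; zero; suc; NonZero; z≤n; s≤s; ⌊_/2⌋; ⌈_/2⌉)
import Data.Nat.Coprimality as Coprime
open import Data.Nat.Divisibility using (n∣m*n)
open import Data.Nat.DivMod using
  (m%n<n; m%n≤m; m/n≤m; m≡m%n+[m/n]*n; m<n*o⇒m/o<n; +-distrib-/-∣ˡ; m*n/n≡m; m<n⇒m/n≡0;
   [m+kn]%n≡m%n; m<n⇒m%n≡m)
import Data.Nat.Properties as ℕ
import Data.Nat.Solver as ℕ
open import Data.Product.Base using (Σ-syntax; ∃-syntax; _×_; _,_; proj₁; proj₂)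
open import Data.Rational.Base as ℚ using (ℚ)
import Data.Rational.Properties as ℚ
open import Data.Sum.Base using (inj₁; inj₂)
open import Data.Vec.Functional as Vector using (Vector)
open import Function.Base using (_∘_; case_of_)
open import Function.Bundles using (mk⇔)
open import Level using (Level)
open import Relation.Binary.Definitions using (DecidableEquality; tri<; tri≈; tri>)
open import Relation.Binary.PropositionalEquality using
  (_≡_; _≢_; refl; sym; trans; cong; cong₂; subst; subst₂)
open import Relation.Binary.Structures using (IsStrictTotalOrder)
open import Relation.Nullary using (¬_; Dec; yes; no; contradiction)

private variable
  X Y : Set

-- Counting subpaths with multiplicity

∈-prefixes⁺ : ∀ {x : X} {s u} → Prefix _≡_ (x ∷ s) u → x ∷ s ∈ Inits.tail u
∈-prefixes⁺ {s = []}    (refl ∷ p) = here refl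
∈-prefixes⁺ {s = _ ∷ _} (refl ∷ p) = there (∈-map⁺ _ (∈-prefixes⁺ p))

∈-prefixes⁻ : ∀ {s : List X} u → s ∈ Inits.tail u → s ≢ [] × Prefix _≡_ s u
∈-prefixes⁻ (x ∷ u) (here refl) = (λ ()) , refl ∷ []
∈-prefixes⁻ (x ∷ u) (there s∈)
  with t , t∈ , refl ← ∈-map⁻ (x ∷_) s∈ = (λ ()) , refl ∷ proj₂ (∈-prefixes⁻ u t∈)

∈-subpaths⁺ : ∀ {s u : List X} {us} → s ≢ [] → Prefix _≡_ s u → u ∈ us → s ∈ concatMap Inits.tail us
∈-subpaths⁺ {s = []}    s≢[] p u∈us = contradiction refl s≢[]
∈-subpaths⁺ {s = _ ∷ _} s≢[] p (here refl) = ∈-++⁺ˡ (∈-prefixes⁺ p)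
∈-subpaths⁺ {s = _ ∷ _} {us = v ∷ _} s≢[] p (there u∈us) = ∈-++⁺ʳ (Inits.tail v) (∈-subpaths⁺ s≢[] p u∈us)

∈-subpaths⁻ : ∀ {s : List X} us → s ∈ concatMap Inits.tail us →
              s ≢ [] × (∃[ u ] u ∈ us × Prefix _≡_ s u)
∈-subpaths⁻ (u ∷ us) s∈ with ∈-++⁻ (Inits.tail u) s∈
... | inj₁ s∈u with s≢[] , p ← ∈-prefixes⁻ u s∈u = s≢[] , u , here refl , p
... | inj₂ s∈us with s≢[] , v , v∈us , p ← ∈-subpaths⁻ us s∈us = s≢[] , v , there v∈us , p

prefixes-unique : (u : List X) → Unique (Inits.tail u)
prefixes-unique []      = []
prefixes-unique (x ∷ u) =
  All.map⁺ (nonempty (Inits.tail u) (λ t∈ → proj₁ (∈-prefixes⁻ u t∈)))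
  ∷ map⁺ (λ { refl → refl }) (prefixes-unique u)
  where
  nonempty : ∀ ts → (∀ {t} → t ∈ ts → t ≢ []) → All (λ t → [ x ] ≢ x ∷ t) ts
  nonempty []       _    = []
  nonempty (t ∷ ts) ne = (λ { refl → ne (here refl) refl }) ∷ nonempty ts (ne ∘ there)

-- Finite sums in a commutative ring and double counting

module Sums {c ℓ : Level} (R : CommutativeRing c ℓ) where

  open CommutativeRing R renaming (refl to ≈-refl; sym to ≈-sym; trans to ≈-trans)
  open import Algebra.Properties.CommutativeSemigroup +-commutativeSemigroup
    using (interchange; x∙yz≈y∙xz)
  open import Algebra.Properties.Semiring.Sum semiring
  open import Relation.Binary.Reasoning.Setoid setoid

  total : (X → Carrier) → List X → Carrier
  total g xs = foldr _+_ 0# (map g xs)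

  total-cong : {g h : X → Carrier} → (∀ x → g x ≈ h x) → ∀ xs → total g xs ≈ total h xs
  total-cong g≈h []       = ≈-refl
  total-cong g≈h (x ∷ xs) = +-cong (g≈h x) (total-cong g≈h xs)

  total-↭ : (g : X → Carrier) {xs ys : List X} → xs ↭ ys → total g xs ≈ total g ys
  total-↭ g Perm.refl          = ≈-refl
  total-↭ g (Perm.prep x p)    = +-congˡ (total-↭ g p)
  total-↭ g (Perm.swap x y p)  = ≈-trans (x∙yz≈y∙xz _ _ _) (+-congˡ (+-congˡ (total-↭ g p)))
  total-↭ g (Perm.trans p q)   = ≈-trans (total-↭ g p) (total-↭ g q)

  total-++ : (g : X → Carrier) → ∀ xs ys → total g (xs ++ ys) ≈ total g xs + total g ys
  total-++ g []       ys = ≈-sym (+-identityˡ _)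
  total-++ g (x ∷ xs) ys = ≈-trans (+-congˡ (total-++ g xs ys)) (≈-sym (+-assoc _ _ _))

  total-zero : {g : X → Carrier} → (∀ x → g x ≈ 0#) → ∀ xs → total g xs ≈ 0#
  total-zero g≈0 []       = ≈-refl
  total-zero g≈0 (x ∷ xs) = ≈-trans (+-cong (g≈0 x) (total-zero g≈0 xs)) (+-identityˡ 0#)

  total-+ : (g h : X → Carrier) → ∀ xs → total (λ x → g x + h x) xs ≈ total g xs + total h xs
  total-+ g h []       = ≈-sym (+-identityˡ 0#)
  total-+ g h (x ∷ xs) = ≈-trans (+-congˡ (total-+ g h xs)) (interchange _ _ _ _)

  *-distribˡ-total : ∀ y (g : X → Carrier) xs → y * total g xs ≈ total (λ x → y * g x) xs
  *-distribˡ-total y g []       = zeroʳ y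
  *-distribˡ-total y g (x ∷ xs) = ≈-trans (distribˡ _ _ _) (+-congˡ (*-distribˡ-total y g xs))

  sum-zero : ∀ {m} {v : Vector Carrier m} → (∀ i → v i ≈ 0#) → sum v ≈ 0#
  sum-zero {m} v≈0 = ≈-trans (sum-cong-≋ v≈0) (sum-replicate-zero m)

  sum-total-comm : ∀ {m} (g : Fin m → X → Carrier) xs →
                   sum (λ i → total (g i) xs) ≈ total (λ x → sum (λ i → g i x)) xs
  sum-total-comm {m = m} g []       = sum-replicate-zero m
  sum-total-comm         g (x ∷ xs) =
    ≈-trans (∑-distrib-+ (λ i → g i x) (λ i → total (g i) xs)) (+-congˡ (sum-total-comm g xs))

  foldl≈total : (g : X → Carrier) → ∀ y xs → foldl (λ z x → z + g x) y xs ≈ y + total g xs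
  foldl≈total g y []       = ≈-sym (+-identityʳ y)
  foldl≈total g y (x ∷ xs) = ≈-trans (foldl≈total g (y + g x) xs) (+-assoc _ _ _)

  module Counting (nat : ℕ → Carrier) (nat-zero : nat 0 ≈ 0#)
                  (nat-suc : ∀ n → nat (suc n) ≈ 1# + nat n) where

    module _ {P : X → Y → Set} (P? : ∀ x y → Dec (P x y)) (g : X → Carrier) where

      -- The inductive step of `double-count` for one `y`: counting in `[ y ]` gives a factor `1` or
      -- `0`, and `h` carries the contribution of the remaining elements.
      total-filter : ∀ y (h : X → Carrier) xs →
        total (λ x → g x * nat (length (filter (P? x) [ y ])) + h x) xs ≈
        total g (filter (λ x → P? x y) xs) + total h xs
      total-filter y h [] = ≈-sym (+-identityˡ 0#)
      total-filter y h (x ∷ xs) with P? x y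
      ... | yes _ = begin
        (g x * nat 1 + h x) + _                ≈⟨ +-cong (+-congʳ g*1) (total-filter y h xs) ⟩
        (g x + h x) + (_ + total h xs)         ≈⟨ interchange _ _ _ _ ⟩
        (g x + _) + (h x + total h xs)         ∎
        where
        g*1 : g x * nat 1 ≈ g x
        g*1 = ≈-trans (*-congˡ (≈-trans (nat-suc 0) (≈-trans (+-congˡ nat-zero) (+-identityʳ 1#))))
                (*-identityʳ (g x))
      ... | no _ = begin
        (g x * nat 0 + h x) + _
          ≈⟨ +-cong (+-congʳ (≈-trans (*-congˡ nat-zero) (zeroʳ (g x)))) (total-filter y h xs) ⟩
        (0# + h x) + (_ + total h xs) ≈⟨ +-congʳ (+-identityˡ (h x)) ⟩
        h x + (_ + total h xs)   ≈⟨ x∙yz≈y∙xz _ _ _ ⟩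
        _ + (h x + total h xs)   ∎

      count-split : ∀ x y ys → g x * nat (length (filter (P? x) (y ∷ ys))) ≈
        g x * nat (length (filter (P? x) [ y ])) + g x * nat (length (filter (P? x) ys))
      count-split x y ys with P? x y
      ... | yes _ = ≈-trans (*-congˡ nat-split) (distribˡ _ _ _)
        where
        nat-split : nat (suc (length (filter (P? x) ys))) ≈ nat 1 + nat (length (filter (P? x) ys))
        nat-split = ≈-trans (nat-suc _) (+-congʳ
          (≈-sym (≈-trans (nat-suc 0) (≈-trans (+-congˡ nat-zero) (+-identityʳ 1#)))))
      ... | no _ = ≈-sym (≈-trans (+-congʳ (≈-trans (*-congˡ nat-zero) (zeroʳ (g x)))) (+-identityˡ _))

      -- Exchange of summation: both sides add up `g x` over the pairs `(x , y)` with `P x y`.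
      double-count : ∀ xs ys →
        total (λ x → g x * nat (length (filter (P? x) ys))) xs ≈
        total (λ y → total g (filter (λ x → P? x y) xs)) ys
      double-count xs [] = total-zero (λ x → ≈-trans (*-congˡ nat-zero) (zeroʳ (g x))) xs
      double-count xs (y ∷ ys) = begin
        total (λ x → g x * nat (length (filter (P? x) (y ∷ ys)))) xs
          ≈⟨ total-cong (λ x → count-split x y ys) xs ⟩
        total (λ x → g x * nat (length (filter (P? x) [ y ])) + g x * nat (length (filter (P? x) ys))) xs
          ≈⟨ total-filter y (λ x → g x * nat (length (filter (P? x) ys))) xs ⟩
        total g (filter (λ x → P? x y) xs) + total (λ x → g x * nat (length (filter (P? x) ys))) xs
          ≈⟨ +-congˡ (double-count xs ys) ⟩
        _ ∎

    -- With `p l` the `l`-th power of the decay, `l` the length of `s` and `c i` its number of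
    -- occurrences in the `i`-th support vector, this is the weight `W(s)`.
    combination : (ℕ → Carrier) → ∀ {m} → Vector Carrier m → ℕ → (Fin m → ℕ) → Carrier
    combination p α l c = sum (λ i → α i * (p l * nat (c i)))

    combination-cong : ∀ p {m} (α : Vector Carrier m) {l l′ c c′} → l ≡ l′ → (∀ i → c i ≡ c′ i) →
                       combination p α l c ≈ combination p α l′ c′
    combination-cong p α refl c≡c′ =
      sum-cong-≋ (λ i → *-congˡ (*-congˡ (reflexive (cong nat (c≡c′ i)))))

    combination-zero : ∀ p {m} (α : Vector Carrier m) l {c} → (∀ i → c i ≡ 0) → combination p α l c ≈ 0#
    combination-zero p α l c≡0 = sum-zero (λ i → ≈-trans
      (*-congˡ (≈-trans (*-congˡ (≈-trans (reflexive (cong nat (c≡0 i))) nat-zero)) (zeroʳ (p l))))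
      (zeroʳ (α i)))

    module _ {A : Set} (_≟_ : DecidableEquality A) where

      private
        occurrences : List A → List (List A) → ℕ
        occurrences s us = length (filter (prefix? _≟_ s) us)

        distinct : List (List A) → List (List A) → List (List A)
        distinct us vs = deduplicate (≡-dec _≟_) (concatMap Inits.tail us ++ concatMap Inits.tail vs)

      -- Both lists are free of duplicates and have the same elements, because `v ∈ vs` puts every
      -- nonempty prefix of `v` among the subpaths.
      prefixes-of-distinct : ∀ us vs {v} → v ∈ vs →
        filter (λ s → prefix? _≟_ s v) (distinct us vs) ↭ Inits.tail v
      prefixes-of-distinct us vs {v} v∈vs = ∼bag⇒↭ (unique∧set⇒bag
        (filter⁺ (λ s → prefix? _≟_ s v) (deduplicate-! (≡-dec _≟_) subs))
        (prefixes-unique v) (mk⇔ to from))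
        where
        subs : List (List A)
        subs = concatMap Inits.tail us ++ concatMap Inits.tail vs
        nonempty : ∀ {s} → s ∈ subs → s ≢ []
        nonempty s∈ with ∈-++⁻ (concatMap Inits.tail us) s∈
        ... | inj₁ s∈us = proj₁ (∈-subpaths⁻ us s∈us)
        ... | inj₂ s∈vs = proj₁ (∈-subpaths⁻ vs s∈vs)
        to : ∀ {s} → s ∈ filter (λ s → prefix? _≟_ s v) (distinct us vs) → s ∈ Inits.tail v
        to {s} s∈ with ∈-filter⁻ (λ s → prefix? _≟_ s v) {xs = distinct us vs} s∈
        -- The empty string is a prefix of `v` missing from `Inits.tail v`, but it is not a subpath
        -- either.
        to {[]} s∈ | s∈subs , p =
          contradiction refl (nonempty (∈-deduplicate⁻ (≡-dec _≟_) subs s∈subs))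
        to {_ ∷ _} s∈ | _ , p = ∈-prefixes⁺ p
        from : ∀ {s} → s ∈ Inits.tail v → s ∈ filter (λ s → prefix? _≟_ s v) (distinct us vs)
        from s∈ with s≢[] , p ← ∈-prefixes⁻ v s∈ =
          ∈-filter⁺ (λ s → prefix? _≟_ s v)
            (∈-deduplicate⁺ (≡-dec _≟_)
              (∈-++⁺ʳ (concatMap Inits.tail us) (∈-subpaths⁺ s≢[] p v∈vs))) p

      -- After `double-count`, the inner sum for each `v` runs over the nonempty prefixes of `v`, so
      -- that the factor counting occurrences turns into repetition in the list.
      total-distinct : (g : List A → Carrier) → ∀ us vs →
        total (λ s → g s * nat (occurrences s vs)) (distinct us vs) ≈ total g (concatMap Inits.tail vs)
      total-distinct g us vs = ≈-trans
        (double-count (prefix? _≟_) g (distinct us vs) vs) (regroup vs (λ v∈ → v∈))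
        where
        -- Only the list summed over shrinks in the induction; `distinct us vs` stays fixed.
        regroup : ∀ vs′ → (∀ {v} → v ∈ vs′ → v ∈ vs) →
          total (λ v → total g (filter (λ s → prefix? _≟_ s v) (distinct us vs))) vs′ ≈
          total g (concatMap Inits.tail vs′)
        regroup []        _  = ≈-refl
        regroup (v ∷ vs′) ⊆ = ≈-trans
          (+-cong (total-↭ g (prefixes-of-distinct us vs (⊆ (here refl)))) (regroup vs′ (⊆ ∘ there)))
          (≈-sym (total-++ g (Inits.tail v) (concatMap Inits.tail vs′)))

      -- The list `distinct (us i) vs` varies with `i`. Once `total-distinct` has replaced it by the
      -- prefixes of the strings in `vs`, which are the same for all `i`, the two sums can be
      -- exchanged.
      prediction : ∀ p {m} (α : Vector Carrier m) (c : Fin m → List A → ℕ)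
        (us : Fin m → List (List A)) vs →
        sum (λ i → α i * total (λ s → p (length s) * nat (c i s) * nat (occurrences s vs)) (distinct (us i) vs)) ≈
        total (λ s → combination p α (length s) (λ i → c i s)) (concatMap Inits.tail vs)
      prediction p α c us vs = begin
        sum (λ i → α i * total (λ s → g i s * nat (occurrences s vs)) (distinct (us i) vs))
          ≈⟨ sum-cong-≋ (λ i → *-congˡ (total-distinct (g i) (us i) vs)) ⟩
        sum (λ i → α i * total (g i) (concatMap Inits.tail vs))
          ≈⟨ sum-cong-≋ (λ i → *-distribˡ-total (α i) (g i) (concatMap Inits.tail vs)) ⟩
        sum (λ i → total (λ s → α i * g i s) (concatMap Inits.tail vs))
          ≈⟨ sum-total-comm (λ i s → α i * g i s) (concatMap Inits.tail vs) ⟩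
        total (λ s → combination p α (length s) (λ i → c i s)) (concatMap Inits.tail vs) ∎
        where
        g : Fin _ → List A → Carrier
        g i s = p (length s) * nat (c i s)

open Defs using (_+_; _*_; _≈_)

-- Runs of the machine

nth-++ˡ : ∀ (xs : List X) {ys i x} → nth xs i ≡ just x → nth (xs ++ ys) i ≡ just x
nth-++ˡ (x ∷ xs) {i = zero}  eq = eq
nth-++ˡ (x ∷ xs) {i = suc i} eq = nth-++ˡ xs eq

nth-++ʳ : ∀ (xs : List X) {ys} i → nth (xs ++ ys) (length xs ℕ.+ i) ≡ nth ys i
nth-++ʳ []       i = refl
nth-++ʳ (x ∷ xs) i = nth-++ʳ xs i

nth-map : ∀ (g : X → Y) xs {i x} → nth xs i ≡ just x → nth (map g xs) i ≡ just (g x)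
nth-map g (x ∷ xs) {zero}  refl = refl
nth-map g (x ∷ xs) {suc i} eq   = nth-map g xs eq

nth-applyUpTo : ∀ (g : ℕ → X) {n i} → i ℕ.< n → nth (applyUpTo g n) i ≡ just (g i)
nth-applyUpTo g {i = zero}  (s≤s _)   = refl
nth-applyUpTo g {i = suc i} (s≤s i<n) = nth-applyUpTo (g ∘ suc) i<n

nth-just⇒< : ∀ (xs : List X) {i x} → nth xs i ≡ just x → i ℕ.< length xs
nth-just⇒< (x ∷ xs) {zero}  eq = s≤s z≤n
nth-just⇒< (x ∷ xs) {suc i} eq = s≤s (nth-just⇒< xs eq)

nthOr-just : ∀ (d : X) xs {i x} → nth xs i ≡ just x → nthOr d xs i ≡ x
nthOr-just d xs {i} eq with nth xs i | eq
... | just x | refl = refl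

toℕ-word : ∀ w {n} → n ℕ.< 2 ℕ.^ w → toℕ (word w n) ≡ n
toℕ-word w {n} n< = trans
  (Fin.toℕ-fromℕ< (m%n<n n (2 ℕ.^ w) {{ℕ.m^n≢0 2 w}})) (m<n⇒m%n≡m {{ℕ.m^n≢0 2 w}} n<)

module _ {w : ℕ} (a b : Word w) where

  toℕ-quot : ∀ B .{{_ : NonZero B}} → toℕ b ≡ B → toℕ (evalWord w quot a b) ≡ toℕ a ℕ./ B
  toℕ-quot (suc B) eq with toℕ b
  toℕ-quot (suc B) refl | suc B =
    toℕ-word w (ℕ.≤-<-trans (m/n≤m (toℕ a) (suc B)) (Fin.toℕ<n a))

  toℕ-rem : ∀ B .{{_ : NonZero B}} → toℕ b ≡ B → toℕ (evalWord w rem a b) ≡ toℕ a ℕ.% B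
  toℕ-rem (suc B) eq with toℕ b
  toℕ-rem (suc B) refl | suc B =
    toℕ-word w (ℕ.≤-<-trans (m%n≤m (toℕ a) (suc B)) (Fin.toℕ<n a))

module _ {w : ℕ} (a b : Reg) (t l : Loc)
         {g : Reg → Word w} {x : Reg → ℝ} {h : Word w → Word w} {y : Word w → ℝ} where

  private
    at : Loc → State w
    at k = state k g x h y

  jumpEq-yes : toℕ (g a) ≡ toℕ (g b) → exec (jumpEq a b t) (at l) ≡ at t
  jumpEq-yes eq with toℕ (g a) ℕ.≟ toℕ (g b)
  ... | yes _ = refl
  ... | no ≢  = contradiction eq ≢

  jumpEq-no : toℕ (g a) ≢ toℕ (g b) → exec (jumpEq a b t) (at l) ≡ at (suc l)
  jumpEq-no ≢ with toℕ (g a) ℕ.≟ toℕ (g b)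
  ... | yes eq = contradiction eq ≢
  ... | no _  = refl

  jumpLt-yes : toℕ (g a) ℕ.< toℕ (g b) → exec (jumpLt a b t) (at l) ≡ at t
  jumpLt-yes lt with toℕ (g a) ℕ.<? toℕ (g b)
  ... | yes _ = refl
  ... | no ≮  = contradiction lt ≮

  jumpLt-no : ¬ toℕ (g a) ℕ.< toℕ (g b) → exec (jumpLt a b t) (at l) ≡ at (suc l)
  jumpLt-no ≮ with toℕ (g a) ℕ.<? toℕ (g b)
  ... | yes lt = contradiction lt ≮
  ... | no _  = refl

module Execution (w : ℕ) (P : Program) where

  -- Total correctness from the state `s` with a time bound; `chain` adds the bounds of consecutive
  -- pieces of a run.
  record Reach (b : ℕ) (s : State w) (Q : State w → Set) : Set where
    constructor reach
    field
      time   : ℕ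
      time≤b : time ℕ.≤ b
      holds  : Q (run P time s)

  run-+ : ∀ t u (s : State w) → run P (t ℕ.+ u) s ≡ run P u (run P t s)
  run-+ zero    u s = refl
  run-+ (suc t) u s = run-+ t u (step P s)

  after : ∀ t {s Q} → Q (run P t s) → Reach t s Q
  after t q = reach t ℕ.≤-refl q

  chain : ∀ {b c s Q R} → Reach b s Q → (∀ {s′} → Q s′ → Reach c s′ R) → Reach (b ℕ.+ c) s R
  chain {R = R} (reach t t≤b q) k with reach u u≤c r ← k q =
    reach (t ℕ.+ u) (ℕ.+-mono-≤ t≤b u≤c) (subst R (sym (run-+ t u _)) r)

  weaken : ∀ {b c s Q} → b ℕ.≤ c → Reach b s Q → Reach c s Q
  weaken b≤c (reach t t≤b q) = reach t (ℕ.≤-trans t≤b b≤c) q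

-- The query program

-- Registers: 2 holds the base B, 3 the node whose suffix is read, 4 the node
-- reached on the way to the root, 5 the pointer of the current trie state,
-- 7 the constant 1, 8 the address of the parents and 9 the constant 0.
predict : Program
predict =
    -- Register 9 is 0 initially and never written, so this reads address 0, where the base is
    -- stored.
    wload 2 9
  ∷ wconst 7 1
  ∷ wop add 8 0 1
  -- Location 3, once per suffix: the pointer of the root of the trie is 1, the constant in register
  -- 7.
  ∷ wmove 4 3
  ∷ wmove 5 7
  -- Location 5, once per node on the way up: the two digits of the label are followed in the trie,
  -- and the weight found there is added to real register 0.
  ∷ wop add 6 0 4
  ∷ wload 6 6
  ∷ wop quot 10 6 2
  ∷ wop add 10 5 10
  ∷ wload 5 10
  ∷ wop rem 10 6 2
  ∷ wop add 10 5 10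
  ∷ wload 5 10
  ∷ rload 1 5
  ∷ rop add 0 0 1
  -- The walk ends at node 0, the root, and otherwise moves on to the parent.
  ∷ jumpEq 4 9 19
  ∷ wop add 6 8 4
  ∷ wload 4 6
  ∷ jump 5
  ∷ wop add 3 3 7
  ∷ jumpLt 3 1 3
  ∷ []

-- Paths to the root in the preorder arrays

data Path {A : Set} (vs : List (A × ℕ)) : ℕ → List A → Set where
  root  : ∀ {a p} → nth vs 0 ≡ just (a , p) → Path vs 0 [ a ]
  -- In preorder a parent precedes its children; this bounds the length of the path from a node by
  -- the number of the node plus one.
  child : ∀ {u a p s} → nth vs (suc u) ≡ just (a , p) → p ℕ.≤ u → Path vs p s →
          Path vs (suc u) (a ∷ s)

data Paths {A : Set} (vs : List (A × ℕ)) : ℕ → List (List A) → Set where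
  []  : ∀ {i} → Paths vs i []
  _∷_ : ∀ {i s ss} → Path vs i s → Paths vs (suc i) ss → Paths vs i (s ∷ ss)

module _ {A : Set} {vs : List (A × ℕ)} where

  Paths-++ : ∀ {i} ss {ss′} → Paths vs i ss → Paths vs (i ℕ.+ length ss) ss′ → Paths vs i (ss ++ ss′)
  Paths-++ {i} [] {ss′} [] qs = subst (λ j → Paths vs j ss′) (ℕ.+-identityʳ i) qs
  Paths-++ {i} (s ∷ ss) {ss′} (p ∷ ps) qs =
    p ∷ Paths-++ ss ps (subst (λ j → Paths vs j ss′) (ℕ.+-suc i (length ss)) qs)

  Slice : ℕ → List (A × ℕ) → Set
  Slice i xs = ∀ k {x} → nth xs k ≡ just x → nth vs (i ℕ.+ k) ≡ just x

  Slice-++ˡ : ∀ {i} xs {ys} → Slice i (xs ++ ys) → Slice i xs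
  Slice-++ˡ xs sl k eq = sl k (nth-++ˡ xs eq)

  Slice-++ʳ : ∀ {i} xs {ys} → Slice i (xs ++ ys) → Slice (i ℕ.+ length xs) ys
  Slice-++ʳ {i} xs sl k eq =
    trans (cong (nth vs) (ℕ.+-assoc i (length xs) k)) (sl (length xs ℕ.+ k) (trans (nth-++ʳ xs k) eq))

  Slice-tail : ∀ {i x xs} → Slice i (x ∷ xs) → Slice (suc i) xs
  Slice-tail {i} sl k eq = trans (cong (nth vs) (sym (ℕ.+-suc i k))) (sl (suc k) eq)

  Slice-head : ∀ {i x xs} → Slice i (x ∷ xs) → nth vs i ≡ just x
  Slice-head {i} sl = trans (cong (nth vs) (sym (ℕ.+-identityʳ i))) (sl 0 refl)

size-pos : ∀ {A : Set} (t : Tree A) → 0 ℕ.< size t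
size-pos (node a ts) = s≤s z≤n

mutual
  length-nodesFrom : ∀ {A : Set} p i (t : Tree A) → length (nodesFrom p i t) ≡ size t
  length-nodesFrom p i (node a ts) = cong suc (length-nodesFrom* i (suc i) ts)

  length-nodesFrom* : ∀ {A : Set} p i (ts : List (Tree A)) → length (nodesFrom* p i ts) ≡ sizes ts
  length-nodesFrom* p i []       = refl
  length-nodesFrom* p i (t ∷ ts) = trans (length-++ (nodesFrom p i t))
    (cong₂ ℕ._+_ (length-nodesFrom p i t) (length-nodesFrom* p (i ℕ.+ size t) ts))

mutual
  length-suffixesBelow : ∀ {A : Set} u (t : Tree A) → length (suffixesBelow u t) ≡ size t
  length-suffixesBelow u (node a ts) = cong suc (length-suffixesBelow* (a ∷ u) ts)

  length-suffixesBelow* : ∀ {A : Set} u (ts : List (Tree A)) → length (suffixesBelow* u ts) ≡ sizes ts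
  length-suffixesBelow* u []       = refl
  length-suffixesBelow* u (t ∷ ts) = trans (length-++ (suffixesBelow u t))
    (cong₂ ℕ._+_ (length-suffixesBelow u t) (length-suffixesBelow* u ts))

module _ {A : Set} {vs : List (A × ℕ)} where

  mutual
    -- Nodes and suffixes are listed in the same preorder, so one induction on the tree matches
    -- them. Numbers have the form `suc i` here because node 0 is the root.
    paths-below : ∀ {p i u} t → p ℕ.≤ i → Path vs p u → Slice {vs = vs} (suc i) (nodesFrom p (suc i) t) →
                  Paths vs (suc i) (suffixesBelow u t)
    paths-below {p} {i} (node a ts) p≤i up sl = this ∷ paths-below* ts ℕ.≤-refl this (Slice-tail {vs = vs} sl)
      where
      this : Path vs (suc i) _
      this = child (Slice-head {vs = vs} sl) p≤i up

    paths-below* : ∀ {p i u} ts → p ℕ.≤ i → Path vs p u → Slice {vs = vs} (suc i) (nodesFrom* p (suc i) ts) →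
                   Paths vs (suc i) (suffixesBelow* u ts)
    paths-below* []       p≤i up sl = []
    paths-below* {p} {i} {u} (t ∷ ts) p≤i up sl = Paths-++ (suffixesBelow u t)
      (paths-below t p≤i up (Slice-++ˡ {vs = vs} (nodesFrom p (suc i) t) sl))
      (subst (λ l → Paths vs (suc i ℕ.+ l) (suffixesBelow* u ts)) (sym (length-suffixesBelow u t))
        (paths-below* ts (ℕ.≤-trans p≤i (ℕ.m≤m+n i (size t))) up
          (subst (λ l → Slice {vs = vs} (suc i ℕ.+ l) (nodesFrom* p (suc (i ℕ.+ size t)) ts))
            (length-nodesFrom p (suc i) t)
            (Slice-++ʳ {vs = vs} (nodesFrom p (suc i) t) sl))))

suffixes-paths : ∀ {A : Set} (T : Tree A) → Paths (nodesFrom 0 0 T) 0 (suffixes T)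
suffixes-paths (node a ts) =
  root refl ∷ paths-below* ts z≤n (root refl) (λ k eq → eq)

-- Correctness and running time of the query program

overall-bound : ∀ n → 0 ℕ.< n → 3 ℕ.+ (n ℕ.* (14 ℕ.* n ℕ.+ 4) ℕ.+ 0) ℕ.≤ 21 ℕ.* n ℕ.^ 2
-- The left side is 3 steps of set-up and at most `14 * n + 4` steps for each of the `n` suffixes.
-- For `n = 1 + k` the two sides differ by `10 * k + 7 * k * k`.
overall-bound n@(suc k) _ = subst (3 ℕ.+ (n ℕ.* (14 ℕ.* n ℕ.+ 4) ℕ.+ 0) ℕ.≤_)
  (solve 1 (λ k → let n = con 1 :+ k in
      con 3 :+ (n :* (con 14 :* n :+ con 4) :+ con 0) :+ (con 10 :* k :+ con 7 :* k :* k)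
      := con 21 :* (n :* (n :* con 1))) refl k)
  (ℕ.m≤m+n _ (10 ℕ.* k ℕ.+ 7 ℕ.* k ℕ.* k))
  where open ℕ.+-*-Solver

-- The program is verified against an abstract layout of the memory: `state-ptr s` is the address
-- reached after reading the labels `s`, `half-ptr s a` the one after the first digit of `a` as
-- well, and `ω s` the weight stored for `s`.
module Prediction
  {A : Set} {w : ℕ} (code : A → Word w) (D : DataStructure w) (T : Tree A)
  (B : ℕ) .{{_ : NonZero B}} (state-ptr : List A → ℕ) (half-ptr : List A → A → ℕ) (ω : List A → ℝ)
  (fits : Fits code D T)
  (start : state-ptr [] ≡ 1)
  (read-base : ∃[ b ] nth (words D) 0 ≡ just b × toℕ b ≡ B)
  (read-hi : ∀ s a → ∃[ p ] nth (words D) (state-ptr s ℕ.+ toℕ (code a) ℕ./ B) ≡ just p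
                          × toℕ p ≡ half-ptr s a)
  (read-lo : ∀ s a → ∃[ p ] nth (words D) (half-ptr s a ℕ.+ toℕ (code a) ℕ.% B) ≡ just p
                          × toℕ p ≡ state-ptr (s ∷ʳ a))
  (read-ω : ∀ s → nth (reals D) (state-ptr s) ≡ just (ω s))
  where

  vs : List (A × ℕ)
  vs = nodesFrom 0 0 T

  n base : ℕ
  n    = size T
  base = length (words D)

  labels parents : List (Word w)
  labels  = map (λ v → code (proj₁ v)) vs
  parents = map (λ v → word w (proj₂ v)) vs

  length-labels : length labels ≡ n
  length-labels = trans (length-map _ vs) (length-nodesFrom 0 0 T)

  nth-bound : ∀ {k v} → nth (wordImage code D T) k ≡ just v → k ℕ.< 2 ℕ.^ w
  nth-bound eq = ℕ.<-≤-trans (nth-just⇒< (wordImage code D T) eq) (proj₁ fits)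

  -- Abstract, so that the type checker does not unfold the memory image.
  abstract

    mem : Word w → Word w
    mem = wmem (initial code D T)

    rmem₀ : Word w → ℝ
    rmem₀ = rmem (initial code D T)

    initial-mem : wmem (initial code D T) ≡ mem
    initial-mem = refl

    initial-rmem : rmem (initial code D T) ≡ rmem₀
    initial-rmem = refl

    read : ∀ {x k v} → toℕ x ≡ k → nth (wordImage code D T) k ≡ just v → mem x ≡ v
    read refl eq = nthOr-just (word w 0) (wordImage code D T) eq

    read-real : ∀ {x s} → toℕ x ≡ state-ptr s → rmem₀ x ≡ ω s
    read-real {s = s} x≡ = nthOr-just 0ℝ (reals D) (trans (cong (nth (reals D)) x≡) (read-ω s))

  read-sum : ∀ x y {k v} → toℕ x ℕ.+ toℕ y ≡ k → nth (wordImage code D T) k ≡ just v →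
             mem (evalWord w add x y) ≡ v
  read-sum x y refl eq = read (toℕ-word w (nth-bound eq)) eq

  nth-label : ∀ {u a p} → nth vs u ≡ just (a , p) →
              nth (wordImage code D T) (base ℕ.+ u) ≡ just (code a)
  nth-label {u} eq = trans (nth-++ʳ (words D) u) (nth-++ˡ labels (nth-map _ vs eq))

  nth-parent : ∀ {u a p} → nth vs u ≡ just (a , p) →
               nth (wordImage code D T) (base ℕ.+ n ℕ.+ u) ≡ just (word w p)
  nth-parent {u} eq = trans (cong (nth (wordImage code D T)) (ℕ.+-assoc base n u))
    (trans (nth-++ʳ (words D) (n ℕ.+ u))
      (trans (cong (λ l → nth (labels ++ parents) (l ℕ.+ u)) (sym length-labels))
        (trans (nth-++ʳ labels u) (nth-map _ vs eq))))

  open Execution w predict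

  record Frame (j : ℕ) (g : Reg → Word w) : Set where
    field
      r0 : toℕ (g 0) ≡ base
      r1 : toℕ (g 1) ≡ n
      r2 : toℕ (g 2) ≡ B
      r3 : toℕ (g 3) ≡ j
      r7 : toℕ (g 7) ≡ 1
      r8 : toℕ (g 8) ≡ base ℕ.+ n
      r9 : toℕ (g 9) ≡ 0

  _⊕_ : ℝ → List A → ℝ
  x ⊕ s = x + ω s

  -- The result of a block of instructions is packed into a predicate, since its
  -- register file, as a term, is exponentially large in the length of the block.
  record At (l j : ℕ) (y : ℝ) (s : State w) : Set where
    constructor here
    field
      pc≡   : pc s ≡ l
      wmem≡ : wmem s ≡ mem
      rmem≡ : rmem s ≡ rmem₀
      frame : Frame j (wreg s)
      acc≡  : rreg s 0 ≡ y

  record Climbing (l j u p : ℕ) (y : ℝ) (s : State w) : Set where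
    constructor climbing
    field
      at   : At l j y s
      pos  : toℕ (wreg s 4) ≡ u
      ptr  : toℕ (wreg s 5) ≡ p

  record Reading (l j u p v : ℕ) (y : ℝ) (s : State w) : Set where
    constructor reading
    field
      position : Climbing l j u p y s
      label    : toℕ (wreg s 6) ≡ v

  -- From here on, each lemma treats the instructions between the two locations in its statement,
  -- and the argument of `Reach` is the number of steps that they take.
  read-label : ∀ {u a p j q y σ} → nth vs u ≡ just (a , p) → Climbing 5 j u q y σ →
               Reach 2 σ (Reading 7 j u q (toℕ (code a)) y)
  read-label {σ = state _ g x _ _} uth (climbing (here refl refl refl fr acc) r4 r5) =
    -- Rebuilding the frame field by field lets each field reduce past the register updates, none of
    -- which concerns a register of the frame.
    after 2 (reading (climbing (here refl refl refl (record { Frame fr }) acc) r4 r5)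
      (cong toℕ (read-sum (g 0) (g 4) (cong₂ ℕ._+_ (Frame.r0 fr) r4) (nth-label uth))))

  follow-hi : ∀ {u a j y s σ} → Reading 7 j u (state-ptr s) (toℕ (code a)) y σ →
              Reach 3 σ (Reading 10 j u (half-ptr s a) (toℕ (code a)) y)
  follow-hi {a = a} {s = s} {state _ g x _ _} (reading (climbing (here refl refl refl fr acc) r4 r5) r6)
    with v , s-hi , v≡ ← read-hi s a =
    after 3 (reading (climbing (here refl refl refl (record { Frame fr }) acc) r4
      (trans (cong toℕ (read-sum (g 5) (evalWord w quot (g 6) (g 2))
        (cong₂ ℕ._+_ r5 (trans (toℕ-quot (g 6) (g 2) B (Frame.r2 fr)) (cong (ℕ._/ B) r6)))
        (nth-++ˡ (words D) s-hi))) v≡)) r6)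

  follow-lo : ∀ {u a j y s σ} → Reading 10 j u (half-ptr s a) (toℕ (code a)) y σ →
              Reach 3 σ (Climbing 13 j u (state-ptr (s ∷ʳ a)) y)
  follow-lo {a = a} {s = s} {state _ g x _ _} (reading (climbing (here refl refl refl fr acc) r4 r5) r6)
    with v , s-lo , v≡ ← read-lo s a =
    after 3 (climbing (here refl refl refl (record { Frame fr }) acc) r4
      (trans (cong toℕ (read-sum (g 5) (evalWord w rem (g 6) (g 2))
        (cong₂ ℕ._+_ r5 (trans (toℕ-rem (g 6) (g 2) B (Frame.r2 fr)) (cong (ℕ._% B) r6)))
        (nth-++ˡ (words D) s-lo))) v≡))

  add-weight : ∀ {u j y s σ} → Climbing 13 j u (state-ptr s) y σ →
               Reach 2 σ (Climbing 15 j u (state-ptr s) (y ⊕ s))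
  add-weight {σ = state _ g x _ _} (climbing (here refl refl refl fr acc) r4 r5) =
    after 2 (climbing (here refl refl refl fr (cong₂ _+_ acc (read-real r5))) r4 r5)

  move : ∀ {s u a p j y σ} → nth vs u ≡ just (a , p) → Climbing 5 j u (state-ptr s) y σ →
         Reach 10 σ (Climbing 15 j u (state-ptr (s ∷ʳ a)) (y ⊕ (s ∷ʳ a)))
  move uth c = chain (read-label uth c) λ c₁ → chain (follow-hi c₁) λ c₂ →
    chain (follow-lo c₂) add-weight

  exit : ∀ {j u p y} → u ≡ 0 → ∀ {σ} → Climbing 15 j u p y σ → Reach 1 σ (At 19 j y)
  exit u≡0 {state _ g x _ _} (climbing (here refl refl refl fr acc) r4 _) =
    after 1 (subst (At 19 _ _) (sym (jumpEq-yes 4 9 19 15 (trans r4 (trans u≡0 (sym (Frame.r9 fr))))))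
      (here refl refl refl fr acc))

  stay : ∀ {j u p y} → u ≢ 0 → ∀ {σ} → Climbing 15 j u p y σ → Reach 1 σ (Climbing 16 j u p y)
  stay u≢0 {state _ g x _ _} (climbing (here refl refl refl fr acc) r4 r5) =
    after 1 (subst (Climbing 16 _ _ _ _)
      (sym (jumpEq-no 4 9 19 15 λ eq → u≢0 (trans (sym r4) (trans eq (Frame.r9 fr)))))
      (climbing (here refl refl refl fr acc) r4 r5))

  ascend : ∀ {u a p j q y} → nth vs u ≡ just (a , p) → p ℕ.≤ u → ∀ {σ} → Climbing 16 j u q y σ →
           Reach 3 σ (Climbing 5 j p q y)
  ascend {u} {a} {p} uth p≤u {state _ g x _ _} (climbing (here refl refl refl fr acc) r4 r5) =
    after 3 (climbing (here refl refl refl (record { Frame fr }) acc) parent≡ r5)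
    where
    parent≡ : toℕ (mem (evalWord w add (g 8) (g 4))) ≡ p
    parent≡ = trans
      (cong toℕ (read-sum (g 8) (g 4) (cong₂ ℕ._+_ (Frame.r8 fr) r4) (nth-parent uth)))
      -- Parents are stored modulo `2 ^ w`; `p` is unchanged since it is at most `u`, hence below an
      -- address in use.
      (toℕ-word w (ℕ.≤-<-trans (ℕ.≤-trans p≤u (ℕ.m≤n+m u (base ℕ.+ n))) (nth-bound (nth-parent uth))))

  -- Induction on the path, where `s` is the string already read. A node other than the root costs
  -- `10 + 1 + 3 = 14` steps, the root `10 + 1`, and parents have smaller numbers.
  climb : ∀ {u t} → Path vs u t → ∀ s {j y σ} → Climbing 5 j u (state-ptr s) y σ →
          Reach (14 ℕ.* suc u) σ (At 19 j (foldl _⊕_ y (map (s ++_) (Inits.tail t))))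
  climb (root 0th) s c =
    weaken (ℕ.m≤n+m 11 3) (chain (move 0th c) (exit refl))
  climb (child {u} {a} {p} {t} uth p≤u up) s {j} {y} c =
    weaken bound (chain (move uth c) λ c₁ → chain (stay (λ ()) c₁) λ c₂ →
      chain (ascend uth (ℕ.m≤n⇒m≤1+n p≤u) c₂) λ c₃ →
        subst (λ z → Reach (14 ℕ.* suc p) _ (At 19 j z)) acc′≡ (climb up (s ∷ʳ a) c₃))
    where
    acc′≡ : foldl _⊕_ (y ⊕ (s ∷ʳ a)) (map ((s ∷ʳ a) ++_) (Inits.tail t)) ≡
            foldl _⊕_ y (map (s ++_) (Inits.tail (a ∷ t)))
    acc′≡ = cong (foldl _⊕_ (y ⊕ (s ∷ʳ a)))
      (trans (map-cong (λ r → ++-assoc s [ a ] r) (Inits.tail t)) (map-∘ (Inits.tail t)))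
    bound : 10 ℕ.+ (1 ℕ.+ (3 ℕ.+ 14 ℕ.* suc p)) ℕ.≤ 14 ℕ.* suc (suc u)
    bound = ℕ.≤-trans (ℕ.+-monoʳ-≤ 14 (ℕ.*-monoʳ-≤ 14 (s≤s p≤u)))
      (ℕ.≤-reflexive (sym (ℕ.*-suc 14 (suc u))))

  base+2n≤ : base ℕ.+ (n ℕ.+ n) ℕ.≤ 2 ℕ.^ w
  base+2n≤ = ℕ.≤-trans (ℕ.≤-reflexive (sym (trans (length-++ (words D))
    (cong (base ℕ.+_) (trans (length-++ labels) (cong₂ ℕ._+_ length-labels
      (trans (length-map _ vs) (length-nodesFrom 0 0 T)))))))) (proj₁ fits)

  0<n : 0 ℕ.< n
  0<n = size-pos T

  n+n≤ : n ℕ.+ n ℕ.≤ 2 ℕ.^ w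
  n+n≤ = ℕ.≤-trans (ℕ.m≤n+m (n ℕ.+ n) base) base+2n≤

  enter : ∀ {j y σ} → At 3 j y σ → Reach 2 σ (Climbing 5 j j (state-ptr []) y)
  enter {σ = state _ g x _ _} (here refl refl refl fr acc) =
    after 2 (climbing (here refl refl refl (record { Frame fr }) acc)
      (Frame.r3 fr) (trans (Frame.r7 fr) (sym start)))

  advance : ∀ {j y σ} → j ℕ.< n → At 19 j y σ → Reach 1 σ (At 20 (suc j) y)
  advance {j} {σ = state _ g x _ _} j<n (here refl refl refl fr acc) =
    after 1 (here refl refl refl (record { Frame fr ; r3 = next-node }) acc)
    where
    next-node : toℕ (evalWord w add (g 3) (g 7)) ≡ suc j
    next-node = trans
      (cong (toℕ {2 ℕ.^ w}) (cong (word w) (trans (cong₂ ℕ._+_ (Frame.r3 fr) (Frame.r7 fr)) (ℕ.+-comm j 1))))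
      (toℕ-word w (ℕ.≤-<-trans j<n (ℕ.<-≤-trans (ℕ.m<m+n n (ℕ.≤-<-trans z≤n j<n)) n+n≤)))

  repeat : ∀ {j y σ} → j ℕ.< n → At 20 j y σ → Reach 1 σ (At 3 j y)
  repeat {j} {y} {state _ g x _ _} j<n (here refl refl refl fr acc) =
    after 1 (subst (At 3 j y)
      (sym (jumpLt-yes 3 1 3 20 (subst₂ ℕ._<_ (sym (Frame.r3 fr)) (sym (Frame.r1 fr)) j<n)))
      (here refl refl refl fr acc))

  finish : ∀ {j y σ} → ¬ j ℕ.< n → At 20 j y σ → Reach 1 σ (At 21 j y)
  finish {j} {y} {state _ g x _ _} j≮n (here refl refl refl fr acc) =
    after 1 (subst (At 21 j y)
      (sym (jumpLt-no 3 1 3 20 (λ lt → j≮n (subst₂ ℕ._<_ (Frame.r3 fr) (Frame.r1 fr) lt))))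
      (here refl refl refl fr acc))

  -- Entering node `j` takes 2 steps, climbing at most `14 * suc j ≤ 14 * n`, and the counter and
  -- the jump take 2. The loop is tested at its end, so the list of remaining suffixes is nonempty
  -- at its start.
  sweep : ∀ {j t ts} → Paths vs j (t ∷ ts) → j ℕ.+ length (t ∷ ts) ≡ n → ∀ {y σ} → At 3 j y σ →
          Reach (length (t ∷ ts) ℕ.* (14 ℕ.* n ℕ.+ 4)) σ
            (At 21 n (foldl _⊕_ y (concatMap Inits.tail (t ∷ ts))))
  sweep {j} {t} {ts} (path ∷ paths) j+≡n {y} σ₀ =
    weaken bound (chain (enter σ₀) λ c → chain (climb path [] c) λ σ₁ →
      chain (advance j<n σ₁) (rest ts paths j+≡n))
    where
    j<n : j ℕ.< n
    j<n = subst (j ℕ.<_) j+≡n (ℕ.m<m+n j (s≤s z≤n))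
    y′ : ℝ
    y′ = foldl _⊕_ y (map ([] ++_) (Inits.tail t))
    y′≡ : ∀ ts → foldl _⊕_ y′ (concatMap Inits.tail ts) ≡ foldl _⊕_ y (concatMap Inits.tail (t ∷ ts))
    y′≡ ts = trans
      (cong (λ r → foldl _⊕_ (foldl _⊕_ y r) (concatMap Inits.tail ts)) (map-id (Inits.tail t)))
      (sym (foldl-++ _⊕_ y (Inits.tail t) (concatMap Inits.tail ts)))
    rest : ∀ ts → Paths vs (suc j) ts → j ℕ.+ length (t ∷ ts) ≡ n → ∀ {σ} → At 20 (suc j) y′ σ →
           Reach (1 ℕ.+ length ts ℕ.* (14 ℕ.* n ℕ.+ 4)) σ
             (At 21 n (foldl _⊕_ y (concatMap Inits.tail (t ∷ ts))))
    rest [] _ last {σ} σ₂ =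
      subst₂ (λ k z → Reach 1 σ (At 21 k z)) 1+j≡n (y′≡ []) (finish (ℕ.<-irrefl 1+j≡n) σ₂)
      where
      1+j≡n : suc j ≡ n
      1+j≡n = trans (ℕ.+-comm 1 j) last
    rest (t′ ∷ ts′) ps more {σ} σ₂ =
      subst (λ z → Reach (1 ℕ.+ length (t′ ∷ ts′) ℕ.* (14 ℕ.* n ℕ.+ 4)) σ (At 21 n z)) (y′≡ (t′ ∷ ts′))
        (chain (repeat 1+j<n σ₂) (sweep ps more′))
      where
      more′ : suc j ℕ.+ length (t′ ∷ ts′) ≡ n
      more′ = trans (sym (ℕ.+-suc j (length (t′ ∷ ts′)))) more
      1+j<n : suc j ℕ.< n
      1+j<n = subst (suc j ℕ.<_) more′ (ℕ.m<m+n (suc j) (s≤s z≤n))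
    bound : 2 ℕ.+ (14 ℕ.* suc j ℕ.+ (1 ℕ.+ (1 ℕ.+ length ts ℕ.* (14 ℕ.* n ℕ.+ 4)))) ℕ.≤
            length (t ∷ ts) ℕ.* (14 ℕ.* n ℕ.+ 4)
    bound = begin
      2 ℕ.+ (14 ℕ.* suc j ℕ.+ (2 ℕ.+ R))  ≤⟨ ℕ.+-monoʳ-≤ 2 (ℕ.+-monoˡ-≤ (2 ℕ.+ R) (ℕ.*-monoʳ-≤ 14 j<n)) ⟩
      2 ℕ.+ (14 ℕ.* n ℕ.+ (2 ℕ.+ R))
        ≡⟨ solve 2 (λ a r → con 2 :+ (a :+ (con 2 :+ r)) := a :+ con 4 :+ r) refl (14 ℕ.* n) R ⟩
      14 ℕ.* n ℕ.+ 4 ℕ.+ R                ∎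
      where
      open ℕ.≤-Reasoning
      open ℕ.+-*-Solver
      R : ℕ
      R = length ts ℕ.* (14 ℕ.* n ℕ.+ 4)

  set-up : Reach 3 (initial code D T) (At 3 0 0ℝ)
  set-up = after 3 (here refl initial-mem initial-rmem (record
    { r0 = toℕ-base
    ; r1 = toℕ-n
    ; r2 = r2≡
    ; r3 = toℕ-0
    -- `1 < 2 ^ w`, because the two arrays of the query have at least one entry each and fit into
    -- the memory.
    ; r7 = toℕ-word w (ℕ.<-≤-trans (ℕ.+-mono-≤ 0<n 0<n) n+n≤)
    ; r8 = trans (cong (toℕ {2 ℕ.^ w}) (cong (word w) (cong₂ ℕ._+_ toℕ-base toℕ-n)))
                 (toℕ-word w (ℕ.<-≤-trans (ℕ.+-monoʳ-< base (ℕ.m<m+n n 0<n)) base+2n≤))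
    ; r9 = toℕ-0
    }) refl)
    where
    toℕ-0 : toℕ (word w 0) ≡ 0
    toℕ-0 = toℕ-word w (ℕ.m^n>0 2 w)
    toℕ-n : toℕ (word w n) ≡ n
    toℕ-n = toℕ-word w (ℕ.<-≤-trans (ℕ.m<m+n n 0<n) n+n≤)
    toℕ-base : toℕ (word w base) ≡ base
    toℕ-base = toℕ-word w (ℕ.<-≤-trans (ℕ.m<m+n base (ℕ.<-≤-trans 0<n (ℕ.m≤m+n n n))) base+2n≤)
    r2≡ : toℕ (wmem (initial code D T) (word w 0)) ≡ B
    r2≡ = trans (cong toℕ (nthOr-just (word w 0) (wordImage code D T)
        (trans (cong (nth (wordImage code D T)) toℕ-0) (nth-++ˡ (words D) (proj₁ (proj₂ read-base))))))
      (proj₂ (proj₂ read-base))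

  predict-correct : Reach (21 ℕ.* n ℕ.^ 2) (initial code D T)
    (λ s → Halted predict s × rreg s 0 ≡ foldl _⊕_ 0ℝ (subpaths T))
  predict-correct = weaken (overall-bound n 0<n) (chain set-up λ σ₀ →
    chain (whole (suffixes-paths T) (length-suffixesBelow [] T) σ₀)
      λ { {state _ _ _ _ _} (here refl _ _ _ acc) → after 0 (refl , acc) })
    where
    whole : ∀ {ss} → Paths vs 0 ss → length ss ≡ n → ∀ {σ} → At 3 0 0ℝ σ →
            Reach (n ℕ.* (14 ℕ.* n ℕ.+ 4)) σ (At 21 n (foldl _⊕_ 0ℝ (concatMap Inits.tail ss)))
    whole {[]} _ eq = contradiction 0<n (subst (λ k → ¬ 0 ℕ.< k) eq λ ())
    whole {t ∷ ts} ps eq {σ} σ₀ = subst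
      (λ k → Reach (k ℕ.* (14 ℕ.* n ℕ.+ 4)) σ
        (At 21 n (foldl _⊕_ 0ℝ (concatMap Inits.tail (t ∷ ts)))))
      eq (sweep ps eq σ₀)

-- The value of f, term by term of its Cauchy sequence

-- Here `y` is a bare sequence, so that no proof of its being Cauchy has to be compared.
pointwise⇒~ : ∀ x y → (∀ n → seq x n ≡ y n) → seq x ~ y
pointwise⇒~ x y x≡y ε 0<ε with N , close ← cauchy x ε 0<ε =
  N , λ k l N≤k N≤l → subst (λ q → ℚ.∣ seq x k ℚ.- q ∣ ℚ.< ε) (x≡y l) (close k l N≤k N≤l)

ℕ→ℚ : ℕ → ℚ
ℕ→ℚ c = ℤ.+ c ℚ./ 1

-- Addition of rationals reduces once numerators and denominators are explicit; `c` is coprime to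
-- `1`, so `normalize-coprime` exhibits those of `ℕ→ℚ c`.
ℕ→ℚ-suc : ∀ c → ℕ→ℚ (suc c) ≡ ℚ.1ℚ ℚ.+ ℕ→ℚ c
ℕ→ℚ-suc c = trans (cong (ℚ._/ 1) (sym (cong (ℤ._+_ (ℤ.+ 1)) (ℤ.*-identityʳ (ℤ.+ c)))))
  (cong (ℚ.1ℚ ℚ.+_) (sym (ℚ.normalize-coprime {c} {0} (Coprime.sym (Coprime.1-coprimeTo c)))))

open Sums ℚ.+-*-commutativeRing 
open Counting ℕ→ℚ refl ℕ→ℚ-suc
open import Algebra.Properties.Semiring.Sum (CommutativeRing.semiring ℚ.+-*-commutativeRing)
  using (sum; sum-cong-≗)

module _ (n : ℕ) where

  -- Operations on reals act on every term of the sequences. This turns sums of reals into sums in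
  -- `ℚ` at each index, where equality is propositional.
  seq-foldr : ∀ (g : X → ℝ) xs →
              seq (foldr _+_ 0ℝ (map g xs)) n ≡ total (λ x → seq (g x) n) xs
  seq-foldr g []       = refl
  seq-foldr g (x ∷ xs) = cong (seq (g x) n ℚ.+_) (seq-foldr g xs)

  seq-foldl : ∀ (g : X → ℝ) y xs →
              seq (foldl (λ z x → z + g x) y xs) n ≡ foldl (λ q x → q ℚ.+ seq (g x) n) (seq y n) xs
  seq-foldl g y []       = refl
  seq-foldl g y (x ∷ xs) = seq-foldl g (y + g x) xs

  seq-∑ : ∀ {m} (v : Vector ℝ m) → seq (∑ v) n ≡ sum (λ i → seq (v i) n)
  seq-∑ {zero}  v = refl
  seq-∑ {suc m} v = cong (seq (v zero) n ℚ.+_) (seq-∑ (v ∘ suc))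

-- Abstract, because comparing reals by unfolding the operations on Cauchy
-- sequences is very slow.
abstract

  combinationℝ : ℝ → ∀ {m} → Vector ℝ m → ℕ → (Fin m → ℕ) → ℝ
  combinationℝ decay αs l c = ∑ (λ i → αs i * (decay ^ l * fromℕ (c i)))

  seq-combination : ∀ decay {m} (αs : Vector ℝ m) l c n →
    seq (combinationℝ decay αs l c) n ≡ combination (λ l → seq (decay ^ l) n) (λ i → seq (αs i) n) l c
  seq-combination decay αs l c n = seq-∑ n (λ i → αs i * (decay ^ l * fromℕ (c i)))

-- The term of index `n` in the sequence of `Kernel.f`, with all sums taken in `ℚ`.
fℚ : {A : Set} (_≟_ : DecidableEquality A) → ℝ → ℕ →
        ∀ {m} → Vector (Tree A) m → Vector ℝ m → Tree A → ℚ
fℚ _≟_ decay n Ts αs T = sum (λ i → seq (αs i) n ℚ.* total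
  (λ s → seq (decay ^ length s) n ℚ.* ℕ→ℚ (Kernel.num _≟_ (Ts i) s) ℚ.* ℕ→ℚ (Kernel.num _≟_ T s))
  (Kernel.distinctSubpaths _≟_ (Ts i) T))

-- The trie

nth-length : ∀ (xs : List X) → nth xs (length xs) ≡ nothing
nth-length []       = refl
nth-length (x ∷ xs) = nth-length xs

module Index (_≟_ : DecidableEquality X) where

  -- An absent element gets the length of the list, which becomes the sink of the trie.
  index : X → List X → ℕ
  index x []       = 0
  index x (y ∷ ys) with x ≟ y
  ... | yes _ = 0
  ... | no  _ = suc (index x ys)

  nth-index : ∀ {x} xs → x ∈ xs → nth xs (index x xs) ≡ just x
  nth-index {x} (y ∷ ys) x∈ with x ≟ y
  nth-index (y ∷ ys) x∈         | yes x≡y = cong just (sym x≡y)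
  nth-index (y ∷ ys) (here x≡y) | no x≢y  = contradiction x≡y x≢y
  nth-index (y ∷ ys) (there x∈) | no x≢y  = nth-index ys x∈

  index-∉ : ∀ {x} xs → x ∉ xs → index x xs ≡ length xs
  index-∉ []           x∉ = refl
  index-∉ {x} (y ∷ ys) x∉ with x ≟ y
  ... | yes x≡y = contradiction (here x≡y) x∉
  ... | no  _   = cong suc (index-∉ ys (x∉ ∘ there))

  index-≤ : ∀ x xs → index x xs ℕ.≤ length xs
  index-≤ x []       = z≤n
  index-≤ x (y ∷ ys) with x ≟ y
  ... | yes _ = z≤n
  ... | no  _ = s≤s (index-≤ x ys)

length-prefixes : ∀ (u : List X) → length (Inits.tail u) ≡ length u
length-prefixes []      = refl
length-prefixes (x ∷ u) = cong suc (trans (length-map (x ∷_) (Inits.tail u)) (length-prefixes u))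

length-subpaths : ∀ {k} {us : List (List X)} → All (λ u → length u ℕ.≤ k) us →
                  length (concatMap Inits.tail us) ℕ.≤ length us ℕ.* k
length-subpaths []                 = z≤n
length-subpaths {us = u ∷ us} (u≤k ∷ us≤k) =
  ℕ.≤-trans (ℕ.≤-reflexive (length-++ (Inits.tail u)))
    (ℕ.+-mono-≤ (ℕ.≤-trans (ℕ.≤-reflexive (length-prefixes u)) u≤k) (length-subpaths us≤k))

Prefix-∷ʳ⁻ : ∀ (s : List X) {c u} → Prefix _≡_ (s ∷ʳ c) u → Prefix _≡_ s u
Prefix-∷ʳ⁻ []      p       = []
Prefix-∷ʳ⁻ (x ∷ s) (e ∷ p) = e ∷ Prefix-∷ʳ⁻ s p

∷ʳ≢[] : ∀ (s : List X) {c} → s ∷ʳ c ≢ []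
∷ʳ≢[] []      ()
∷ʳ≢[] (x ∷ s) ()

-- The trie of a list of words over the digits below B, as an automaton: its
-- states are the positions in nodes, and length nodes is a sink for the strings
-- which do not occur.
module Trie (B : ℕ) .{{_ : NonZero B}} (strings : List (List ℕ)) where

  open Index (≡-dec ℕ._≟_)

  nodes : List (List ℕ)
  nodes = [] ∷ concatMap Inits.tail strings

  find : List ℕ → ℕ
  find σ = index σ nodes

  target : ℕ → ℕ → ℕ
  target v c = maybe′ (λ σ → find (σ ∷ʳ c)) (length nodes) (nth nodes v)

  prefix∈nodes : ∀ {σ u} → u ∈ strings → Prefix _≡_ σ u → σ ∈ nodes
  prefix∈nodes {[]}    u∈ p = here refl
  prefix∈nodes {_ ∷ _} u∈ p = there (∈-subpaths⁺ (λ ()) p u∈)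

  nodes-closed : ∀ σ {c} → σ ∷ʳ c ∈ nodes → σ ∈ nodes
  nodes-closed σ (here eq) = contradiction eq (∷ʳ≢[] σ)
  nodes-closed σ (there σc∈) with _ , u , u∈ , p ← ∈-subpaths⁻ strings σc∈ =
    prefix∈nodes u∈ (Prefix-∷ʳ⁻ σ p)

  nth-find : ∀ {σ} → σ ∈ nodes → nth nodes (find σ) ≡ just σ
  nth-find = nth-index nodes

  nth-find-∉ : ∀ {σ} → σ ∉ nodes → nth nodes (find σ) ≡ nothing
  nth-find-∉ σ∉ = trans (cong (nth nodes) (index-∉ nodes σ∉)) (nth-length nodes)

  -- For a string outside the trie both sides are the sink: `nodes` is closed under removing the
  -- last digit, so no extension of that string is a node.
  target-find : ∀ σ c → target (find σ) c ≡ find (σ ∷ʳ c)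
  target-find σ c with member? (≡-dec ℕ._≟_) σ nodes
  ... | yes σ∈ = cong (maybe′ _ _) (nth-find σ∈)
  ... | no  σ∉ = trans (cong (maybe′ _ _) (nth-find-∉ σ∉)) (sym (index-∉ nodes (σ∉ ∘ nodes-closed σ)))

  -- A state is represented by the address of its row of `B` cells; the `suc` leaves room for
  -- address 0, which holds the base.
  pointer : List ℕ → ℕ
  pointer σ = suc (find σ ℕ.* B)

  -- One row for each node and one for the sink.
  capacity : ℕ
  capacity = suc (length nodes) ℕ.* B

  find*B+c<capacity : ∀ σ {c} → c ℕ.< B → find σ ℕ.* B ℕ.+ c ℕ.< capacity
  find*B+c<capacity σ {c} c<B = begin-strict
    find σ ℕ.* B ℕ.+ c         <⟨ ℕ.+-monoʳ-< (find σ ℕ.* B) c<B ⟩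
    find σ ℕ.* B ℕ.+ B         ≤⟨ ℕ.+-monoˡ-≤ B (ℕ.*-monoˡ-≤ B (index-≤ σ nodes)) ⟩
    length nodes ℕ.* B ℕ.+ B   ≡⟨ ℕ.+-comm (length nodes ℕ.* B) B ⟩
    capacity                   ∎
    where open ℕ.≤-Reasoning

  find*B<capacity : ∀ σ → find σ ℕ.* B ℕ.< capacity
  find*B<capacity σ =
    ℕ.≤-<-trans (ℕ.m≤m+n (find σ ℕ.* B) 0) (find*B+c<capacity σ (ℕ.>-nonZero⁻¹ B))

  quotient : ∀ v {c} → c ℕ.< B → (v ℕ.* B ℕ.+ c) ℕ./ B ≡ v
  quotient v {c} c<B = trans (+-distrib-/-∣ˡ c (n∣m*n v))
    (trans (cong₂ ℕ._+_ (m*n/n≡m v B) (m<n⇒m/n≡0 c<B)) (ℕ.+-identityʳ v))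

  remainder : ∀ v {c} → c ℕ.< B → (v ℕ.* B ℕ.+ c) ℕ.% B ≡ c
  remainder v {c} c<B = trans (cong (ℕ._% B) (ℕ.+-comm (v ℕ.* B) c))
    (trans ([m+kn]%n≡m%n c v B) (m<n⇒m%n≡m c<B))

  module Table (w : ℕ) (weight : List ℕ → ℝ) where

    -- Cells store the address of the target row rather than its number, so that a transition takes
    -- one addition and one load.
    entry : ℕ → Word w
    entry k = word w (suc (target (k ℕ./ B) (k ℕ.% B) ℕ.* B))

    value : ℕ → ℝ
    value v = maybe′ weight 0ℝ (nth nodes v)

    table : DataStructure w
    table = record
      { words = word w B ∷ applyUpTo entry capacity
      -- The real memory has the same layout, with the weight of a state repeated along its row, so
      -- that one pointer serves both memories.
      ; reals = 0ℝ ∷ applyUpTo (λ k → value (k ℕ./ B)) capacity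
      }

    read-word : ∀ σ {c} → c ℕ.< B →
                nth (words table) (pointer σ ℕ.+ c) ≡ just (word w (pointer (σ ∷ʳ c)))
    read-word σ {c} c<B = trans (nth-applyUpTo entry (find*B+c<capacity σ c<B))
      (cong (λ v → just (word w (suc (v ℕ.* B))))
        (trans (cong₂ target (quotient (find σ) c<B) (remainder (find σ) c<B)) (target-find σ c)))

    read-value : ∀ σ → nth (reals table) (pointer σ) ≡ just (value (find σ))
    read-value σ = trans
      (nth-applyUpTo (λ k → value (k ℕ./ B)) (find*B<capacity σ))
      (cong (just ∘ value) (m*n/n≡m (find σ) B))

    value-∈ : ∀ {σ} → σ ∈ nodes → value (find σ) ≡ weight σ
    value-∈ σ∈ = cong (maybe′ weight 0ℝ) (nth-find σ∈)

    value-∉ : ∀ {σ} → σ ∉ nodes → value (find σ) ≡ 0ℝ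
    value-∉ σ∉ = cong (maybe′ weight 0ℝ) (nth-find-∉ σ∉)

    length-words : length (words table) ≡ suc capacity
    length-words = cong suc (length-applyUpTo entry capacity)

    length-reals : length (reals table) ≡ suc capacity
    length-reals = cong suc (length-applyUpTo (λ k → value (k ℕ./ B)) capacity)

    pointer<length : ∀ σ → pointer σ ℕ.< suc capacity
    pointer<length σ = s≤s (find*B<capacity σ)

-- The space taken by trie and query

module Arithmetic (N n w : ℕ) (0<n : 0 ℕ.< n) (large : (1 ℕ.+ N ℕ.+ n) ℕ.^ 9 ℕ.≤ 2 ℕ.^ w) where

  Z B b : ℕ
  Z = 1 ℕ.+ N ℕ.+ n
  B = 2 ℕ.^ ⌈ w /2⌉
  b = 2 ℕ.^ ⌊ w /2⌋

  b*B≡2^w : b ℕ.* B ≡ 2 ℕ.^ w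
  b*B≡2^w = trans (sym (ℕ.^-distribˡ-+-* 2 ⌊ w /2⌋ ⌈ w /2⌉)) (cong (2 ℕ.^_) (ℕ.⌊n/2⌋+⌈n/2⌉≡n w))

  2≤Z : 2 ℕ.≤ Z
  2≤Z = ℕ.+-mono-≤ (s≤s (z≤n {N})) 0<n

  -- The exponent 9 comes from here: `Z ^ 8` is compared with `b * b`, and one more factor `Z ≥ 2`
  -- absorbs the factor 2 by which `B` may exceed `b` when `w` is odd.
  Z⁴≤b : Z ℕ.^ 4 ℕ.≤ b
  Z⁴≤b = ℕ.≮⇒≥ λ b<Z⁴ → ℕ.<-irrefl refl (begin-strict
    Z ℕ.* (b ℕ.* b)               <⟨ ℕ.*-monoʳ-< Z {{ℕ.>-nonZero 0<Z}} (ℕ.*-mono-< b<Z⁴ b<Z⁴) ⟩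
    Z ℕ.* (Z ℕ.^ 4 ℕ.* Z ℕ.^ 4)   ≡⟨ cong (Z ℕ.*_) (sym (ℕ.^-distribˡ-+-* Z 4 4)) ⟩
    Z ℕ.^ 9                       ≤⟨ large ⟩
    2 ℕ.^ w                       ≡⟨ sym b*B≡2^w ⟩
    b ℕ.* B                       ≤⟨ ℕ.*-monoʳ-≤ b (ℕ.^-monoʳ-≤ 2 (ℕ.⌊n/2⌋-mono (ℕ.n≤1+n (suc w)))) ⟩
    b ℕ.* (2 ℕ.* b)               ≡⟨ solve 1 (λ b → b :* (con 2 :* b) := con 2 :* (b :* b)) refl b ⟩
    2 ℕ.* (b ℕ.* b)               ≤⟨ ℕ.*-monoˡ-≤ (b ℕ.* b) 2≤Z ⟩
    Z ℕ.* (b ℕ.* b)               ∎)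
    where
    open ℕ.≤-Reasoning
    open ℕ.+-*-Solver
    0<Z : 0 ℕ.< Z
    0<Z = s≤s z≤n

  -- The left side is at most `4 * Z ^ 2`, with the surplus written out in `difference`, and
  -- `4 ≤ Z ^ 2`.
  quadratic : 3 ℕ.+ N ℕ.* (N ℕ.+ N) ℕ.+ (n ℕ.+ n) ℕ.≤ Z ℕ.^ 4
  quadratic = ℕ.≤-trans (ℕ.≤-trans (ℕ.m≤m+n _ _) (ℕ.≤-reflexive difference)) (begin
    2 ℕ.* 2 ℕ.* (Z ℕ.* Z)    ≤⟨ ℕ.*-monoˡ-≤ (Z ℕ.* Z) (ℕ.*-mono-≤ 2≤Z 2≤Z) ⟩
    Z ℕ.* Z ℕ.* (Z ℕ.* Z)    ≡⟨ solve 1 (λ z → z :* z :* (z :* z) := z :* (z :* (z :* (z :* con 1)))) refl Z ⟩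
    Z ℕ.^ 4                  ∎)
    where
    open ℕ.≤-Reasoning
    open ℕ.+-*-Solver
    difference : 3 ℕ.+ N ℕ.* (N ℕ.+ N) ℕ.+ (n ℕ.+ n) ℕ.+
      (1 ℕ.+ 2 ℕ.* N ℕ.* N ℕ.+ 4 ℕ.* n ℕ.* n ℕ.+ 8 ℕ.* N ℕ.+ 6 ℕ.* n ℕ.+ 8 ℕ.* N ℕ.* n) ≡ 2 ℕ.* 2 ℕ.* (Z ℕ.* Z)
    difference = solve 2 (λ N n → con 3 :+ N :* (N :+ N) :+ (n :+ n) :+
      (con 1 :+ con 2 :* N :* N :+ con 4 :* n :* n :+ con 8 :* N :+ con 6 :* n :+ con 8 :* N :* n)
      := con 2 :* con 2 :* ((con 1 :+ N :+ n) :* (con 1 :+ N :+ n))) refl N n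

  -- The nodes and the sink take `suc v` rows. Each remaining cell, one for the base and `n + n` for
  -- the query, is charged a whole row, and the number of rows is then at most `b`.
  space : ∀ {v} → v ℕ.≤ 1 ℕ.+ N ℕ.* (N ℕ.+ N) → suc (suc v ℕ.* B) ℕ.+ (n ℕ.+ n) ℕ.≤ 2 ℕ.^ w
  space {v} v≤ = begin
    suc (suc v ℕ.* B) ℕ.+ (n ℕ.+ n)
      ≡⟨ solve 2 (λ x y → con 1 :+ x :+ y := x :+ (con 1 :+ y)) refl (suc v ℕ.* B) (n ℕ.+ n) ⟩
    suc v ℕ.* B ℕ.+ suc (n ℕ.+ n)
      ≤⟨ ℕ.+-monoʳ-≤ (suc v ℕ.* B) (ℕ.m≤m*n (suc (n ℕ.+ n)) B {{ℕ.m^n≢0 2 ⌈ w /2⌉}}) ⟩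
    suc v ℕ.* B ℕ.+ suc (n ℕ.+ n) ℕ.* B
      ≡⟨ sym (ℕ.*-distribʳ-+ B (suc v) (suc (n ℕ.+ n))) ⟩
    (suc v ℕ.+ suc (n ℕ.+ n)) ℕ.* B
      ≤⟨ ℕ.*-monoˡ-≤ B (ℕ.≤-trans (ℕ.+-monoˡ-≤ (suc (n ℕ.+ n)) (s≤s v≤)) (ℕ.≤-reflexive
           (solve 2 (λ x y → con 2 :+ x :+ (con 1 :+ y) := con 3 :+ x :+ y) refl (N ℕ.* (N ℕ.+ N)) (n ℕ.+ n)))) ⟩
    (3 ℕ.+ N ℕ.* (N ℕ.+ N) ℕ.+ (n ℕ.+ n)) ℕ.* B
      ≤⟨ ℕ.*-monoˡ-≤ B (ℕ.≤-trans quadratic Z⁴≤b) ⟩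
    b ℕ.* B
      ≡⟨ b*B≡2^w ⟩
    2 ℕ.^ w ∎
    where
    open ℕ.≤-Reasoning
    open ℕ.+-*-Solver

-- The data structure for given support vectors

mutual
  suffixesBelow-bounded : ∀ {A : Set} (u : List A) t →
    All (λ s → length s ℕ.≤ length u ℕ.+ size t) (suffixesBelow u t)
  suffixesBelow-bounded u (node a ts) =
    ℕ.≤-trans (s≤s (ℕ.m≤m+n (length u) (sizes ts))) (ℕ.≤-reflexive (sym (ℕ.+-suc (length u) (sizes ts)))) ∷
    All.map (λ s≤ → ℕ.≤-trans s≤ (ℕ.≤-reflexive (sym (ℕ.+-suc (length u) (sizes ts)))))
      (suffixesBelow*-bounded (a ∷ u) ts)

  suffixesBelow*-bounded : ∀ {A : Set} (u : List A) ts →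
    All (λ s → length s ℕ.≤ length u ℕ.+ sizes ts) (suffixesBelow* u ts)
  suffixesBelow*-bounded u []       = []
  suffixesBelow*-bounded u (t ∷ ts) = All.++⁺
    (All.map (λ s≤ → ℕ.≤-trans s≤ (ℕ.+-monoʳ-≤ (length u) (ℕ.m≤m+n (size t) (sizes ts))))
      (suffixesBelow-bounded u t))
    (All.map (λ s≤ → ℕ.≤-trans s≤ (ℕ.+-monoʳ-≤ (length u) (ℕ.m≤n+m (sizes ts) (size t))))
      (suffixesBelow*-bounded u ts))

allSuffixes : ∀ {A : Set} {m} → Vector (Tree A) m → List (List A)
allSuffixes Ts = Vector.foldr _++_ [] (λ i → suffixes (Ts i))

module _ {A : Set} where

  length-allSuffixes : ∀ {m} (Ts : Vector (Tree A) m) → length (allSuffixes Ts) ≡ totalSize Ts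
  length-allSuffixes {zero}  Ts = refl
  length-allSuffixes {suc m} Ts = trans (length-++ (suffixes (Ts zero)))
    (cong₂ ℕ._+_ (length-suffixesBelow [] (Ts zero)) (length-allSuffixes (Ts ∘ suc)))

  allSuffixes-bounded : ∀ {m} (Ts : Vector (Tree A) m) →
                        All (λ s → length s ℕ.≤ totalSize Ts) (allSuffixes Ts)
  allSuffixes-bounded {zero}  Ts = []
  allSuffixes-bounded {suc m} Ts = All.++⁺
    (All.map (λ s≤ → ℕ.≤-trans s≤ (ℕ.m≤m+n _ _)) (suffixesBelow-bounded [] (Ts zero)))
    (All.map (λ s≤ → ℕ.≤-trans s≤ (ℕ.m≤n+m _ _)) (allSuffixes-bounded (Ts ∘ suc)))

  ∈-allSuffixes : ∀ {m} (Ts : Vector (Tree A) m) i {s} → s ∈ suffixes (Ts i) → s ∈ allSuffixes Ts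
  ∈-allSuffixes Ts zero    s∈ = ∈-++⁺ˡ s∈
  ∈-allSuffixes Ts (suc i) s∈ = ∈-++⁺ʳ (suffixes (Ts zero)) (∈-allSuffixes (Ts ∘ suc) i s∈)

code-injective : (𝔸 : Alphabet) {w : ℕ} (let open Alphabet 𝔸) (code : Label → Word w) →
                 (∀ {a b} → a ≺ b → code a Fin.< code b) →
                 ∀ {a b} → toℕ (code a) ≡ toℕ (code b) → a ≡ b
code-injective 𝔸 code mono {a} {b} eq with IsStrictTotalOrder.compare (Alphabet.isStrictTotalOrder 𝔸) a b
... | tri< a≺b _ _ = contradiction (mono a≺b) (ℕ.<-irrefl eq)
... | tri≈ _ a≡b _ = a≡b
... | tri> _ _ b≺a = contradiction (mono b≺a) (ℕ.<-irrefl (sym eq))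

module Halves {A : Set} (_≟_ : DecidableEquality A) (key : A → ℕ)
              (key-injective : ∀ {a b} → key a ≡ key b → a ≡ b) (B : ℕ) .{{_ : NonZero B}} where

  halves : A → List ℕ
  halves a = key a ℕ./ B ∷ key a ℕ.% B ∷ []

  spell : List A → List ℕ
  spell = concatMap halves

  spell-∷ʳ : ∀ s a → spell (s ∷ʳ a) ≡ spell s ∷ʳ (key a ℕ./ B) ∷ʳ (key a ℕ.% B)
  spell-∷ʳ s a = trans (concatMap-++ halves s [ a ])
    (sym (++-assoc (spell s) [ key a ℕ./ B ] [ key a ℕ.% B ]))

  length-spell : ∀ s → length (spell s) ≡ length s ℕ.+ length s
  length-spell []      = refl
  length-spell (a ∷ s) = cong suc (trans (cong suc (length-spell s)) (sym (ℕ.+-suc (length s) (length s))))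

  spell-prefix⁺ : ∀ {s u} → Prefix _≡_ s u → Prefix _≡_ (spell s) (spell u)
  spell-prefix⁺ []         = []
  spell-prefix⁺ (refl ∷ p) = refl ∷ refl ∷ spell-prefix⁺ p

  -- Quotient and remainder by `B` determine the key, and the key determines the label.
  spell-prefix⁻ : ∀ s u → Prefix _≡_ (spell s) (spell u) → Prefix _≡_ s u
  spell-prefix⁻ []      u       p = []
  spell-prefix⁻ (a ∷ s) (b ∷ u) (hi ∷ lo ∷ p) = key-injective
    (trans (m≡m%n+[m/n]*n (key a) B)
      (trans (cong₂ (λ l h → l ℕ.+ h ℕ.* B) lo hi) (sym (m≡m%n+[m/n]*n (key b) B)))) ∷ spell-prefix⁻ s u p

  count-spell : ∀ s us → length (filter (prefix? ℕ._≟_ (spell s)) (map spell us)) ≡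
                         length (filter (prefix? _≟_ s) us)
  count-spell s []       = refl
  count-spell s (u ∷ us) with prefix? ℕ._≟_ (spell s) (spell u) | prefix? _≟_ s u
  ... | yes _ | yes _ = cong suc (count-spell s us)
  ... | no  _ | no  _ = count-spell s us
  ... | yes p | no ¬q = contradiction (spell-prefix⁻ s u p) ¬q
  ... | no ¬p | yes q = contradiction (spell-prefix⁺ q) ¬p

-- `OutputsWithin` with the expected real replaced by a sequence, which keeps Cauchy proofs of the
-- expected value out of the type.
OutputsPointwise : {A : Set} {w : ℕ} (code : A → Word w) (D : DataStructure w) (T : Tree A) →
                   Program → ℕ → Seq → Set
OutputsPointwise code D T P bound y =
  ∃[ t ] t ℕ.≤ bound × Halted P (run P t (initial code D T)) ×
         seq (rreg (run P t (initial code D T)) 0) ~ y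

module SupportVectors
  {A : Set} (_≟_ : DecidableEquality A) (w : ℕ) (code : A → Word w)
  (code-injective : ∀ {a b} → toℕ (code a) ≡ toℕ (code b) → a ≡ b)
  (decay : ℝ) {m : ℕ} (Ts : Vector (Tree A) m) (αs : Vector ℝ m)
  where

  B : ℕ
  B = 2 ℕ.^ ⌈ w /2⌉

  instance
    B≢0 : NonZero B
    B≢0 = ℕ.m^n≢0 2 ⌈ w /2⌉

  open Halves _≟_ (toℕ ∘ code) code-injective B
  open Trie B (map spell (allSuffixes Ts))

  digitCount : Fin m → List ℕ → ℕ
  digitCount i σ = length (filter (prefix? ℕ._≟_ σ) (map spell (suffixes (Ts i))))

  -- A label consists of two halves, whence ⌊ length σ /2⌋.
  weight : List ℕ → ℝ
  weight σ = combinationℝ decay αs ⌊ length σ /2⌋ (λ i → digitCount i σ)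

  open Table w weight

  num-zero : ∀ s → spell s ∉ nodes → ∀ i → Kernel.num _≟_ (Ts i) s ≡ 0
  num-zero s s∉ i = cong length (filter-none (prefix? _≟_ s) (All.tabulate λ u∈ p →
    s∉ (prefix∈nodes (∈-map⁺ spell (∈-allSuffixes Ts i u∈)) (spell-prefix⁺ p))))

  -- The trie yields `W(s)` for every `s`: by construction if the spelling of `s` is a node, and
  -- otherwise because `s` occurs in no support vector, so that the `0ℝ` of the sink is right.
  seq-value : ∀ n s → seq (value (find (spell s))) n ≡
    combination (λ l → seq (decay ^ l) n) (λ i → seq (αs i) n) (length s) (λ i → Kernel.num _≟_ (Ts i) s)
  seq-value n s = by-membership (member? (≡-dec ℕ._≟_) (spell s) nodes)
    where
    powers : ℕ → ℚ
    powers l = seq (decay ^ l) n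
    coefficients : Vector ℚ m
    coefficients i = seq (αs i) n
    by-membership : Dec (spell s ∈ nodes) → seq (value (find (spell s))) n ≡
      combination powers coefficients (length s) (λ i → Kernel.num _≟_ (Ts i) s)
    by-membership (yes s∈) = trans (cong (λ x → seq x n) (value-∈ s∈))
      (trans (seq-combination decay αs ⌊ length (spell s) /2⌋ (λ i → digitCount i (spell s)) n)
        (combination-cong powers coefficients
          (trans (cong ⌊_/2⌋ (length-spell s)) (sym (ℕ.n≡⌊n+n/2⌋ (length s))))
          (λ i → count-spell s (suffixes (Ts i)))))
    by-membership (no s∉) = trans (cong (λ x → seq x n) (value-∉ s∉))
      (sym (combination-zero powers coefficients (length s) (num-zero s s∉)))

  N : ℕ
  N = totalSize Ts

  -- There are `N` suffixes of at most `N` labels, that is `N + N` digits, each with as many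
  -- nonempty prefixes; the additional node is the empty string.
  length-nodes : length nodes ℕ.≤ 1 ℕ.+ N ℕ.* (N ℕ.+ N)
  length-nodes = s≤s (subst (λ l → length (concatMap Inits.tail (map spell (allSuffixes Ts))) ℕ.≤ l ℕ.* (N ℕ.+ N))
    (trans (length-map spell (allSuffixes Ts)) (length-allSuffixes Ts))
    (length-subpaths (All.map⁺ (All.map (λ {s} s≤N →
      ℕ.≤-trans (ℕ.≤-reflexive (length-spell s)) (ℕ.+-mono-≤ s≤N s≤N)) (allSuffixes-bounded Ts)))))

  -- y is the sequence of f(T), characterised by the shape of its sums.  The label
  -- equality in theorem3 agrees with ours only after unfolding, so that comparing
  -- the two values of f would compare Cauchy proofs, which is infeasible; y, v and
  -- g are instead read off the goal by unification.
  Computes : DataStructure w → Tree A → Set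
  Computes D T = ∀ (y : Seq) (v : ℕ → Fin m → ℚ) (g : Fin m → List A → ℝ) →
    (∀ n → y n ≡ sum (v n)) →
    (∀ n i → v n i ≡ seq (αs i * foldr _+_ 0ℝ (map (g i) (Kernel.distinctSubpaths _≟_ (Ts i) T))) n) →
    (∀ n i s → seq (g i s) n ≡
      seq (decay ^ length s) n ℚ.* ℕ→ℚ (Kernel.num _≟_ (Ts i) s) ℚ.* ℕ→ℚ (Kernel.num _≟_ T s)) →
    OutputsPointwise code D T predict (21 ℕ.* size T ℕ.^ 2) y

  module _ (T : Tree A) (large : (1 ℕ.+ totalSize Ts ℕ.+ size T) ℕ.^ 9 ℕ.≤ 2 ℕ.^ w) where

    open Arithmetic N (size T) w (size-pos T) large using (b*B≡2^w; space)

    total-space : suc capacity ℕ.+ (size T ℕ.+ size T) ℕ.≤ 2 ℕ.^ w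
    total-space = space length-nodes

    length-encoding : length (encodeTree w code T) ≡ size T ℕ.+ size T
    length-encoding = trans (length-++ (map (λ v → code (proj₁ v)) (nodesFrom 0 0 T)))
      (cong₂ ℕ._+_ (trans (length-map _ (nodesFrom 0 0 T)) (length-nodesFrom 0 0 T))
                   (trans (length-map _ (nodesFrom 0 0 T)) (length-nodesFrom 0 0 T)))

    fits : Fits code table T
    fits = ℕ.≤-trans (ℕ.≤-reflexive (trans (length-++ (words table))
             (cong₂ ℕ._+_ length-words length-encoding))) total-space
         , ℕ.≤-trans (ℕ.≤-reflexive length-reals) (ℕ.m+n≤o⇒m≤o (suc capacity) total-space)

    toℕ-pointer : ∀ σ → toℕ (word w (pointer σ)) ≡ pointer σ
    toℕ-pointer σ = toℕ-word w
      (ℕ.<-≤-trans (pointer<length σ) (ℕ.m+n≤o⇒m≤o (suc capacity) total-space))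

    -- The high digit is below `2 ^ ⌊ w /2⌋`, which is at most `B` because the exponent of `B` is
    -- rounded up.
    hi<B : ∀ a → toℕ (code a) ℕ./ B ℕ.< B
    hi<B a = ℕ.<-≤-trans
      (m<n*o⇒m/o<n (subst (toℕ (code a) ℕ.<_) (sym b*B≡2^w) (Fin.toℕ<n (code a))))
      (ℕ.^-monoʳ-≤ 2 (ℕ.⌊n/2⌋≤⌈n/2⌉ w))

    step-read : ∀ σ {c τ} → c ℕ.< B → τ ≡ σ ∷ʳ c →
                ∃[ p ] nth (words table) (pointer σ ℕ.+ c) ≡ just p × toℕ p ≡ pointer τ
    step-read σ {c} c<B refl = word w (pointer (σ ∷ʳ c)) , read-word σ c<B , toℕ-pointer (σ ∷ʳ c)

    open Prediction code table T B (λ s → pointer (spell s))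
      (λ s a → pointer (spell s ∷ʳ (toℕ (code a) ℕ./ B))) (λ s → value (find (spell s)))
      -- The empty string comes first in `nodes`, so that its pointer evaluates to 1.
      fits refl
      (word w B , refl , toℕ-word w (ℕ.<-≤-trans (s≤s (ℕ.m≤m+n B (length nodes ℕ.* B)))
        (ℕ.m+n≤o⇒m≤o (suc capacity) total-space)))
      (λ s a → step-read (spell s) (hi<B a) refl)
      (λ s a → step-read (spell s ∷ʳ (toℕ (code a) ℕ./ B)) (m%n<n (toℕ (code a)) B) (spell-∷ʳ s a))
      (λ s → read-value (spell s))
      using (predict-correct; _⊕_)

    seq-result : ∀ n → seq (foldl _⊕_ 0ℝ (subpaths T)) n ≡ fℚ _≟_ decay n Ts αs T
    seq-result n = trans (seq-foldl n v 0ℝ (subpaths T))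
      (trans (foldl≈total (λ s → seq (v s) n) ℚ.0ℚ (subpaths T))
        (trans (ℚ.+-identityˡ (total (λ s → seq (v s) n) (subpaths T)))
          (trans (total-cong (seq-value n) (subpaths T))
            (sym (prediction _≟_ (λ l → seq (decay ^ l) n) (λ i → seq (αs i) n)
                   (λ i → Kernel.num _≟_ (Ts i)) (λ i → suffixes (Ts i)) (suffixes T))))))
      where
      v : List A → ℝ
      v s = value (find (spell s))

    compute : Computes table T
    compute y v g y≡ v≡ g≡ = time , time≤b , proj₁ holds ,
      pointwise⇒~ (rreg (run predict time (initial code table T)) 0) y
        (λ n → trans (cong (λ x → seq x n) (proj₂ holds)) (trans (seq-result n) (sym (y≡fℚ n))))
      where
      open Execution.Reach predict-correct
      y≡fℚ : ∀ n → y n ≡ fℚ _≟_ decay n Ts αs T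
      y≡fℚ n = trans (y≡ n) (sum-cong-≗ λ i → trans (v≡ n i)
        (cong (seq (αs i) n ℚ.*_) (trans (seq-foldr n (g i) (Kernel.distinctSubpaths _≟_ (Ts i) T))
          (total-cong (g≡ n i) (Kernel.distinctSubpaths _≟_ (Ts i) T)))))

  prediction-structure : Σ[ D ∈ DataStructure w ]
    (∀ T → (1 ℕ.+ totalSize Ts ℕ.+ size T) ℕ.^ 9 ℕ.≤ 2 ℕ.^ w → Fits code D T × Computes D T)
  prediction-structure = table , λ T large → fits T large , compute T large

theorem3 : (decay : ℝ) → 0ℝ < decay → decay ≤ 1ℝ →
    Σ[ P ∈ Program ] Σ[ C ∈ ℕ ] Σ[ k ∈ ℕ ]
    ((A : Alphabet) (w : ℕ) (let open Alphabet A)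
    (code : Label → Word w) →
    (∀ {a b} → a ≺ b → code a Fin.< code b) →
    (m : ℕ) (Ts : Vector (Tree Label) m) (αs : Vector ℝ m) →
    Σ[ D ∈ DataStructure w ]
    ((T : Tree Label) →
    (1 ℕ.+ totalSize Ts ℕ.+ size T) ℕ.^ k ℕ.≤ 2 ℕ.^ w →
    Fits code D T ×
    OutputsWithin code D T P (C ℕ.* size T ℕ.^ 2) (Kernel.f _≟_ decay Ts αs T)))
-- `21` comes from `overall-bound` and `9` from `Z⁴≤b`. The program and both numbers are fixed
-- before alphabet, word length, support vectors and weights.
theorem3 decay _ _ = predict , 21 , 9 , λ A w code mono m Ts αs →
  case SupportVectors.prediction-structure (Alphabet._≟_ A) w code
         (code-injective A {w} code mono) decay Ts αs of
  λ { (D , respond) → D , λ T large → proj₁ (respond T large) ,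
      proj₂ (respond T large) _ _ _ (λ n → seq-∑ n {m} _) (λ n i → refl) (λ n i s → refl) }
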